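{- Let $K=\mathbb{F}_q$ be a finite field. Let $\mathcal{G}$ be a graph with $m$ connected components, each of which is an even cycle $C_{2l_i}$ ($i=1,\ldots,m$), and let $n=2k$ be the number of vertices of $\mathcal{G}$ (so $k=\sum_{i=1}^m l_i$ and the number of edges is $s=n=2k$). Let $\mathbb{X}\subseteq\mathbb{P}^{s-1}$ be the toric set over $K$ parameterized by the edges of $\mathcal{G}$, with vanishing ideal $I_{\mathbb{X}}\subseteq S=K[X_1,\ldots,X_s]$. Then $$\mathrm{reg}(S/I_{\mathbb{X}})=(q-2)(k-1).$$
   Context: Let $K^*=K\setminus\{0\}$. Graphs are simple. $C_{2l}$ denotes the cycle with $2l$ vertices. For a simple graph $\mathcal{G}$ with vertices $v_1,\ldots,v_n$ and edges $e_1,\ldots,e_s$, the toric set parameterized by the edges of $\mathcal{G}$ is the set $\mathbb{X}\subseteq\mathbb{P}^{s-1}$ of all points, for $(t_1,\ldots,t_n)\in(K^*)^n$, whose $i$-th coordinate is $t_jt_l$ when $e_i=\{v_j,v_l\}$. With $S=\oplus_{d\ge0}S_d$ standard graded, $I_{\mathbb{X}}$ is the ideal generated by the homogeneous polynomials vanishing at all points of $\mathbb{X}$, $H_{\mathbb{X}}(d)=\dim_K(S_d/(I_{\mathbb{X}}\cap S_d))$, and the regularity index $\mathrm{reg}(S/I_{\mathbb{X}})$ is the least integer $d\ge0$ such that $H_{\mathbb{X}}(d)=|\mathbb{X}|$. -}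

module Defs where

open import Level using (Level; _⊔_; suc)
open import Algebra.Bundles using (CommutativeMonoid; CommutativeRing; Ring; Semiring)
open import Algebra.Module.Bundles using (LeftModule)
import Algebra.Definitions
import Algebra.Definitions.RawMonoid
import Algebra.Definitions.RawSemiring
import Algebra.Module.Properties.LeftModule
import Algebra.Properties.AbelianGroup
import Algebra.Properties.CommutativeSemigroup
import Algebra.Properties.Ring
open import Data.Fin.Base using (Fin; toℕ)
open import Data.List.Base as List using (List; []; _∷_; _++_; cartesianProductWith)
open import Data.Nat.Base as ℕ using (ℕ; _≤_)
import Data.Nat.Properties as ℕ
open import Data.Product.Base using (Σ; ∃; _×_; _,_; proj₁; proj₂; map₁)
open import Data.Sum.Base using (_⊎_)
open import Data.Vec.Base as Vec using (Vec)
open import Data.Vec.Properties using (≡-dec; zipWith-identityˡ)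
open import Function.Base using (_∘_)
open import Function.Bundles using (Inverse; _↔_; _⇔_)
open import Function.Definitions using (Surjective)
open import Relation.Binary.Bundles using (Setoid)
open import Relation.Binary.Construct.Closure.ReflexiveTransitive using (Star)
open import Relation.Binary.Core using (Rel)
open import Relation.Binary.PropositionalEquality as ≡ using (_≡_; _≢_)
import Relation.Binary.Reasoning.Setoid
open import Relation.Nullary using (¬_; Dec; yes; no)
open import Relation.Unary using (Pred)

------------------------------------------------------------------------
-- Finite cardinality

HasCardinality : ∀ {a ℓ} → Setoid a ℓ → ℕ → Set (a ⊔ ℓ)
HasCardinality A n = Inverse A (≡.setoid (Fin n))

------------------------------------------------------------------------
-- Graphs

-- Each edge is stored with an arbitrary orientation, which `Joins` forgets.
record SimpleGraph (n s : ℕ) : Set where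
  field
    src tgt : Fin s → Fin n

  Joins : Fin s → Fin n → Fin n → Set
  Joins e u v = (src e ≡ u × tgt e ≡ v) ⊎ (src e ≡ v × tgt e ≡ u)

  field
    loopless        : ∀ e → src e ≢ tgt e
    noParallelEdges : ∀ e f → Joins e (src f) (tgt f) → e ≡ f

  Adjacent : Rel (Fin n) _
  Adjacent u v = ∃ λ e → Joins e u v

GraphIso : {V W : Set} → Rel V Level.zero → Rel W Level.zero → Set
GraphIso {V} {W} _~₁_ _~₂_ =
  Σ (V ↔ W) λ φ → ∀ u v → (u ~₁ v) ⇔ (Inverse.to φ u ~₂ Inverse.to φ v)

CycleNext : (N : ℕ) → Rel (Fin N) _
CycleNext N a b = (ℕ.suc (toℕ a) ≡ toℕ b) ⊎ (ℕ.suc (toℕ a) ≡ N × toℕ b ≡ 0)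

-- This is the simple graph C_N only for N ≥ 3.
CycleAdjacent : (N : ℕ) → Rel (Fin N) _
CycleAdjacent N u v = CycleNext N u v ⊎ CycleNext N v u

-- The graph has exactly m connected components, the i-th one being the
-- fibre of `component` over i, and it is a cycle with `len i` vertices.
record ComponentsAreCycles {n s : ℕ} (G : SimpleGraph n s)
                           (m : ℕ) (len : Fin m → ℕ) : Set where
  open SimpleGraph G
  field
    component            : Fin n → Fin m
    component-surjective : Surjective _≡_ _≡_ component
    component-connected  : ∀ u v → (component u ≡ component v) ⇔ Star Adjacent u v

  InducedAdjacent : (i : Fin m) → Rel (∃ λ v → component v ≡ i) _
  InducedAdjacent i u v = Adjacent (proj₁ u) (proj₁ v)

  field
    component-cycle : ∀ i → GraphIso (InducedAdjacent i) (CycleAdjacent (len i))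

------------------------------------------------------------------------
-- Linear algebra

module _ {r ℓr : Level} {R : Ring r ℓr} where

  module _ {m ℓm : Level} (M : LeftModule R m ℓm) where
    open Ring R
    open LeftModule M
    open Algebra.Definitions.RawMonoid +ᴹ-rawMonoid using () renaming (sum to sumᴹ)
    open Algebra.Module.Properties.LeftModule M using (inverseˡ-uniqueᴹ)

    record Submodule (p : Level) : Set (r ⊔ ℓr ⊔ m ⊔ ℓm ⊔ suc p) where
      field
        Member  : Pred Carrierᴹ p
        resp    : ∀ {x y} → x ≈ᴹ y → Member x → Member y
        0-mem   : Member 0ᴹ
        +-mem   : ∀ {x y} → Member x → Member y → Member (x +ᴹ y)
        *ₗ-mem  : ∀ a {x} → Member x → Member (a *ₗ x)

    private
      -1* : ∀ x → (- 1#) *ₗ x ≈ᴹ -ᴹ x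
      -1* x = inverseˡ-uniqueᴹ _ _ (begin
        (- 1#) *ₗ x +ᴹ x          ≈⟨ +ᴹ-congˡ (*ₗ-identityˡ x) ⟨
        (- 1#) *ₗ x +ᴹ 1# *ₗ x    ≈⟨ *ₗ-distribʳ x (- 1#) 1# ⟨
        (- 1# + 1#) *ₗ x          ≈⟨ *ₗ-congʳ (-‿inverseˡ 1#) ⟩
        0# *ₗ x                   ≈⟨ *ₗ-zeroˡ x ⟩
        0ᴹ                        ∎)
        where open Relation.Binary.Reasoning.Setoid ≈ᴹ-setoid

    module _ {p : Level} (N : Submodule p) where
      open Submodule N

      neg-mem : ∀ {x} → Member x → Member (-ᴹ x)
      neg-mem {x} x∈N = resp (-1* x) (*ₗ-mem (- 1#) x∈N)

      subLeftModule : LeftModule R (m ⊔ p) ℓm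
      subLeftModule = record
        { Carrierᴹ = ∃ Member
        ; _≈ᴹ_ = λ x y → proj₁ x ≈ᴹ proj₁ y
        ; _+ᴹ_ = λ (x , x∈) (y , y∈) → (x +ᴹ y) , +-mem x∈ y∈
        ; _*ₗ_ = λ a (x , x∈) → (a *ₗ x) , *ₗ-mem a x∈
        ; 0ᴹ   = 0ᴹ , 0-mem
        ; -ᴹ_  = λ (x , x∈) → (-ᴹ x) , neg-mem x∈
        ; isLeftModule = record
          { isLeftSemimodule = record
            { +ᴹ-isCommutativeMonoid = record
              { isMonoid = record
                { isSemigroup = record
                  { isMagma = record
                    { isEquivalence = record
                      { refl = ≈ᴹ-refl ; sym = ≈ᴹ-sym ; trans = ≈ᴹ-trans }
                    ; ∙-cong = +ᴹ-cong
                    }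
                  ; assoc = λ x y z → +ᴹ-assoc (proj₁ x) (proj₁ y) (proj₁ z)
                  }
                ; identity = (λ x → +ᴹ-identityˡ (proj₁ x)) , (λ x → +ᴹ-identityʳ (proj₁ x))
                }
              ; comm = λ x y → +ᴹ-comm (proj₁ x) (proj₁ y)
              }
            ; isPreleftSemimodule = record
              { *ₗ-cong      = *ₗ-cong
              ; *ₗ-zeroˡ     = λ x → *ₗ-zeroˡ (proj₁ x)
              ; *ₗ-distribʳ  = λ x → *ₗ-distribʳ (proj₁ x)
              ; *ₗ-identityˡ = λ x → *ₗ-identityˡ (proj₁ x)
              ; *ₗ-assoc     = λ a b x → *ₗ-assoc a b (proj₁ x)
              ; *ₗ-zeroʳ     = *ₗ-zeroʳ
              ; *ₗ-distribˡ  = λ a x y → *ₗ-distribˡ a (proj₁ x) (proj₁ y)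
              }
            }
          ; -ᴹ‿cong = -ᴹ‿cong
          ; -ᴹ‿inverse = (λ x → -ᴹ‿inverseˡ (proj₁ x)) , (λ x → -ᴹ‿inverseʳ (proj₁ x))
          }
        }

      _≈/_ : Rel Carrierᴹ p
      x ≈/ y = Member (x +ᴹ (-ᴹ y))

      private
        open Relation.Binary.Reasoning.Setoid ≈ᴹ-setoid
        open Algebra.Properties.AbelianGroup +ᴹ-abelianGroup
          using () renaming (⁻¹-∙-comm to -ᴹ-+ᴹ-comm; ⁻¹-involutive to -ᴹ-involutive)
        open Algebra.Properties.CommutativeSemigroup
          (CommutativeMonoid.commutativeSemigroup +ᴹ-commutativeMonoid)
          using (interchange)

        ≈⇒≈/ : ∀ {x y} → x ≈ᴹ y → x ≈/ y
        ≈⇒≈/ {x} {y} x≈y = resp (≈ᴹ-sym (begin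
          x +ᴹ -ᴹ y  ≈⟨ +ᴹ-congʳ x≈y ⟩
          y +ᴹ -ᴹ y  ≈⟨ -ᴹ‿inverseʳ y ⟩
          0ᴹ         ∎)) 0-mem

        /-sym : ∀ {x y} → x ≈/ y → y ≈/ x
        /-sym {x} {y} x∼y = resp (begin
          -ᴹ (x +ᴹ -ᴹ y)        ≈⟨ -ᴹ-+ᴹ-comm x (-ᴹ y) ⟨
          -ᴹ x +ᴹ -ᴹ (-ᴹ y)     ≈⟨ +ᴹ-congˡ (-ᴹ-involutive y) ⟩
          -ᴹ x +ᴹ y             ≈⟨ +ᴹ-comm _ _ ⟩
          y +ᴹ -ᴹ x             ∎) (neg-mem x∼y)

        /-trans : ∀ {x y z} → x ≈/ y → y ≈/ z → x ≈/ z
        /-trans {x} {y} {z} x∼y y∼z = resp (begin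
          (x +ᴹ -ᴹ y) +ᴹ (y +ᴹ -ᴹ z)   ≈⟨ +ᴹ-assoc _ _ _ ⟩
          x +ᴹ (-ᴹ y +ᴹ (y +ᴹ -ᴹ z))   ≈⟨ +ᴹ-congˡ (+ᴹ-assoc _ _ _) ⟨
          x +ᴹ ((-ᴹ y +ᴹ y) +ᴹ -ᴹ z)   ≈⟨ +ᴹ-congˡ (+ᴹ-congʳ (-ᴹ‿inverseˡ y)) ⟩
          x +ᴹ (0ᴹ +ᴹ -ᴹ z)            ≈⟨ +ᴹ-congˡ (+ᴹ-identityˡ _) ⟩
          x +ᴹ -ᴹ z                    ∎) (+-mem x∼y y∼z)

        /-+-cong : ∀ {x y u v} → x ≈/ y → u ≈/ v → (x +ᴹ u) ≈/ (y +ᴹ v)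
        /-+-cong {x} {y} {u} {v} x∼y u∼v = resp (begin
          (x +ᴹ -ᴹ y) +ᴹ (u +ᴹ -ᴹ v)   ≈⟨ interchange x (-ᴹ y) u (-ᴹ v) ⟩
          (x +ᴹ u) +ᴹ (-ᴹ y +ᴹ -ᴹ v)   ≈⟨ +ᴹ-congˡ (-ᴹ-+ᴹ-comm y v) ⟩
          (x +ᴹ u) +ᴹ -ᴹ (y +ᴹ v)      ∎) (+-mem x∼y u∼v)

        /-neg-cong : ∀ {x y} → x ≈/ y → (-ᴹ x) ≈/ (-ᴹ y)
        /-neg-cong {x} {y} x∼y =
          resp (≈ᴹ-sym (-ᴹ-+ᴹ-comm x (-ᴹ y))) (neg-mem x∼y)

        -ᴹ-*ₗ : ∀ a x → a *ₗ (-ᴹ x) ≈ᴹ -ᴹ (a *ₗ x)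
        -ᴹ-*ₗ a x = inverseˡ-uniqueᴹ _ _ (begin
          a *ₗ (-ᴹ x) +ᴹ a *ₗ x   ≈⟨ *ₗ-distribˡ a (-ᴹ x) x ⟨
          a *ₗ (-ᴹ x +ᴹ x)        ≈⟨ *ₗ-congˡ (-ᴹ‿inverseˡ x) ⟩
          a *ₗ 0ᴹ                 ≈⟨ *ₗ-zeroʳ a ⟩
          0ᴹ                      ∎)

        /-*ₗ-cong : ∀ {a b x y} → a ≈ b → x ≈/ y → (a *ₗ x) ≈/ (b *ₗ y)
        /-*ₗ-cong {a} {b} {x} {y} a≈b x∼y = resp (begin
          a *ₗ (x +ᴹ -ᴹ y)            ≈⟨ *ₗ-distribˡ a x (-ᴹ y) ⟩
          a *ₗ x +ᴹ a *ₗ (-ᴹ y)       ≈⟨ +ᴹ-congˡ (-ᴹ-*ₗ a y) ⟩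
          a *ₗ x +ᴹ -ᴹ (a *ₗ y)       ≈⟨ +ᴹ-congˡ (-ᴹ‿cong (*ₗ-congʳ a≈b)) ⟩
          a *ₗ x +ᴹ -ᴹ (b *ₗ y)       ∎) (*ₗ-mem a x∼y)

      quotientLeftModule : LeftModule R m p
      quotientLeftModule = record
        { Carrierᴹ = Carrierᴹ
        ; _≈ᴹ_ = _≈/_
        ; _+ᴹ_ = _+ᴹ_
        ; _*ₗ_ = _*ₗ_
        ; 0ᴹ   = 0ᴹ
        ; -ᴹ_  = -ᴹ_
        ; isLeftModule = record
          { isLeftSemimodule = record
            { +ᴹ-isCommutativeMonoid = record
              { isMonoid = record
                { isSemigroup = record
                  { isMagma = record
                    { isEquivalence = record
                      { refl = ≈⇒≈/ ≈ᴹ-refl ; sym = /-sym ; trans = /-trans }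
                    ; ∙-cong = /-+-cong
                    }
                  ; assoc = λ x y z → ≈⇒≈/ (+ᴹ-assoc x y z)
                  }
                ; identity = (λ x → ≈⇒≈/ (+ᴹ-identityˡ x)) , (λ x → ≈⇒≈/ (+ᴹ-identityʳ x))
                }
              ; comm = λ x y → ≈⇒≈/ (+ᴹ-comm x y)
              }
            ; isPreleftSemimodule = record
              { *ₗ-cong      = /-*ₗ-cong
              ; *ₗ-zeroˡ     = λ x → ≈⇒≈/ (*ₗ-zeroˡ x)
              ; *ₗ-distribʳ  = λ x a b → ≈⇒≈/ (*ₗ-distribʳ x a b)
              ; *ₗ-identityˡ = λ x → ≈⇒≈/ (*ₗ-identityˡ x)
              ; *ₗ-assoc     = λ a b x → ≈⇒≈/ (*ₗ-assoc a b x)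
              ; *ₗ-zeroʳ     = λ a → ≈⇒≈/ (*ₗ-zeroʳ a)
              ; *ₗ-distribˡ  = λ a x y → ≈⇒≈/ (*ₗ-distribˡ a x y)
              }
            }
          ; -ᴹ‿cong = /-neg-cong
          ; -ᴹ‿inverse = (λ x → ≈⇒≈/ (-ᴹ‿inverseˡ x)) , (λ x → ≈⇒≈/ (-ᴹ‿inverseʳ x))
          }
        }

    linearCombination : ∀ {n} → (Fin n → Carrier) → (Fin n → Carrierᴹ) → Carrierᴹ
    linearCombination a b = sumᴹ (λ i → a i *ₗ b i)

    record IsBasis {n : ℕ} (b : Fin n → Carrierᴹ) : Set (r ⊔ ℓr ⊔ m ⊔ ℓm) where
      field
        independent : ∀ a → linearCombination a b ≈ᴹ 0ᴹ → ∀ i → a i ≈ 0#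
        spanning    : ∀ x → ∃ λ a → x ≈ᴹ linearCombination a b

    HasDimension : ℕ → Set (r ⊔ ℓr ⊔ m ⊔ ℓm)
    HasDimension n = ∃ λ (b : Fin n → Carrierᴹ) → IsBasis b

------------------------------------------------------------------------
-- Fields

-- The classical notion.  The library's HeytingField carries an apartness
-- relation, which is superfluous for finite fields: their equality is decidable.
record IsField {c ℓ : Level} (K : CommutativeRing c ℓ) : Set (c ⊔ ℓ) where
  open CommutativeRing K
  open Algebra.Definitions _≈_ using (Invertible)
  field
    1≉0        : ¬ (1# ≈ 0#)
    invertible : ∀ x → ¬ (x ≈ 0#) → Invertible 1# _*_ x

------------------------------------------------------------------------
-- Polynomials in s variables

module _ {c ℓ : Level} (K : CommutativeRing c ℓ) (s : ℕ) where
  open CommutativeRing K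
  open Algebra.Definitions.RawSemiring (Semiring.rawSemiring semiring) using (product; _^_)
  open Algebra.Properties.Ring ring using (-‿+-comm; -0#≈0#)

  Exponent : Set
  Exponent = Vec ℕ s

  _≟ᵉ_ : (e f : Exponent) → Dec (e ≡ f)
  _≟ᵉ_ = ≡-dec ℕ._≟_

  -- A list of terms, possibly with repeated exponents and zero coefficients;
  -- polynomials are compared through their coefficients.
  Poly : Set c
  Poly = List (Carrier × Exponent)

  termCoeff : Carrier → Exponent → Exponent → Carrier
  termCoeff a e m with e ≟ᵉ m
  ... | yes _ = a
  ... | no _  = 0#

  coeff : Poly → Exponent → Carrier
  coeff []            m = 0#
  coeff ((a , e) ∷ p) m = termCoeff a e m + coeff p m

  _≈ₚ_ : Rel Poly ℓ
  p ≈ₚ q = ∀ m → coeff p m ≈ coeff q m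

  _*ₚ_ : Poly → Poly → Poly
  _*ₚ_ = cartesianProductWith (λ (a , e) (b , f) → a * b , Vec.zipWith ℕ._+_ e f)

  _·ₚ_ : Carrier → Poly → Poly
  a ·ₚ p = List.map (map₁ (a *_)) p

  -ₚ_ : Poly → Poly
  -ₚ_ = List.map (map₁ (-_))

  constant : Carrier → Poly
  constant a = (a , Vec.replicate s 0) ∷ []

  eval : Poly → (Fin s → Carrier) → Carrier
  eval []            x = 0#
  eval ((a , e) ∷ p) x = a * product (λ i → x i ^ Vec.lookup e i) + eval p x

  Homogeneous : ℕ → Pred Poly ℓ
  Homogeneous d p = ∀ m → Vec.sum m ≢ d → coeff p m ≈ 0#

  data Ideal {g : Level} (G : Pred Poly g) : Pred Poly (c ⊔ ℓ ⊔ g) where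
    gen  : ∀ {p} → G p → Ideal G p
    resp : ∀ {p q} → p ≈ₚ q → Ideal G p → Ideal G q
    nil  : Ideal G []
    add  : ∀ {p q} → Ideal G p → Ideal G q → Ideal G (p ++ q)
    mul  : ∀ p {q} → Ideal G q → Ideal G (p *ₚ q)

  coeff-++ : ∀ p q m → coeff (p ++ q) m ≈ coeff p m + coeff q m
  coeff-++ []            q m = sym (+-identityˡ _)
  coeff-++ ((a , e) ∷ p) q m = trans (+-congˡ (coeff-++ p q m)) (sym (+-assoc _ _ _))

  termCoeff-· : ∀ a b e m → termCoeff (a * b) e m ≈ a * termCoeff b e m
  termCoeff-· a b e m with e ≟ᵉ m
  ... | yes _ = refl
  ... | no _  = sym (zeroʳ a)

  coeff-· : ∀ a p m → coeff (a ·ₚ p) m ≈ a * coeff p m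
  coeff-· a []            m = sym (zeroʳ a)
  coeff-· a ((b , e) ∷ p) m =
    trans (+-cong (termCoeff-· a b e m) (coeff-· a p m)) (sym (distribˡ a _ _))

  termCoeff-neg : ∀ b e m → termCoeff (- b) e m ≈ - termCoeff b e m
  termCoeff-neg b e m with e ≟ᵉ m
  ... | yes _ = refl
  ... | no _  = sym -0#≈0#

  coeff-neg : ∀ p m → coeff (-ₚ p) m ≈ - coeff p m
  coeff-neg []            m = sym -0#≈0#
  coeff-neg ((b , e) ∷ p) m =
    trans (+-cong (termCoeff-neg b e m) (coeff-neg p m)) (-‿+-comm _ _)

  constant-*ₚ : ∀ a p → constant a *ₚ p ≡ a ·ₚ p
  constant-*ₚ a []            = ≡.refl
  constant-*ₚ a ((b , e) ∷ p) =
    ≡.cong₂ _∷_ (≡.cong (a * b ,_) (zipWith-identityˡ (λ _ → ≡.refl) e)) (constant-*ₚ a p)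

  polyLeftModule : LeftModule ring c ℓ
  polyLeftModule = record
    { Carrierᴹ = Poly
    ; _≈ᴹ_ = _≈ₚ_
    ; _+ᴹ_ = _++_
    ; _*ₗ_ = _·ₚ_
    ; 0ᴹ   = []
    ; -ᴹ_  = -ₚ_
    ; isLeftModule = record
      { isLeftSemimodule = record
        { +ᴹ-isCommutativeMonoid = record
          { isMonoid = record
            { isSemigroup = record
              { isMagma = record
                { isEquivalence = record
                  { refl  = λ _ → refl
                  ; sym   = λ p≈q m → sym (p≈q m)
                  ; trans = λ p≈q q≈r m → trans (p≈q m) (q≈r m)
                  }
                ; ∙-cong = λ {p} {p₁} {q} {q₁} p≈p₁ q≈q₁ m →
                    via (coeff-++ p q m) (+-cong (p≈p₁ m) (q≈q₁ m)) (coeff-++ p₁ q₁ m)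
                }
              ; assoc = λ p q r m →
                  via (trans (coeff-++ (p ++ q) r m) (+-congʳ (coeff-++ p q m)))
                      (+-assoc _ _ _)
                      (trans (coeff-++ p (q ++ r) m) (+-congˡ (coeff-++ q r m)))
              }
            ; identity = (λ _ _ → refl)
                       , (λ p m → trans (coeff-++ p [] m) (+-identityʳ _))
            }
          ; comm = λ p q m → via (coeff-++ p q m) (+-comm _ _) (coeff-++ q p m)
          }
        ; isPreleftSemimodule = record
          { *ₗ-cong      = λ {a} {b} {p} {q} a≈b p≈q m →
              via (coeff-· a p m) (*-cong a≈b (p≈q m)) (coeff-· b q m)
          ; *ₗ-zeroˡ     = λ p m → trans (coeff-· 0# p m) (zeroˡ _)
          ; *ₗ-distribʳ  = λ p a b m →
              via (coeff-· (a + b) p m) (distribʳ _ a b)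
                  (trans (coeff-++ (a ·ₚ p) (b ·ₚ p) m)
                         (+-cong (coeff-· a p m) (coeff-· b p m)))
          ; *ₗ-identityˡ = λ p m → trans (coeff-· 1# p m) (*-identityˡ _)
          ; *ₗ-assoc     = λ a b p m →
              via (coeff-· (a * b) p m) (*-assoc a b _)
                  (trans (coeff-· a (b ·ₚ p) m) (*-congˡ (coeff-· b p m)))
          ; *ₗ-zeroʳ     = λ _ _ → refl
          ; *ₗ-distribˡ  = λ a p q m →
              via (trans (coeff-· a (p ++ q) m) (*-congˡ (coeff-++ p q m)))
                  (distribˡ a _ _)
                  (trans (coeff-++ (a ·ₚ p) (a ·ₚ q) m)
                         (+-cong (coeff-· a p m) (coeff-· a q m)))
          }
        }
      ; -ᴹ‿cong = λ {p} {q} p≈q m →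
          via (coeff-neg p m) (-‿cong (p≈q m)) (coeff-neg q m)
      ; -ᴹ‿inverse =
          (λ p m → trans (coeff-++ (-ₚ p) p m)
                     (trans (+-congʳ (coeff-neg p m)) (-‿inverseˡ _)))
        , (λ p m → trans (coeff-++ p (-ₚ p) m)
                     (trans (+-congˡ (coeff-neg p m)) (-‿inverseʳ _)))
      }
    }
    where
    via : ∀ {w x y z} → w ≈ x → x ≈ y → z ≈ y → w ≈ z
    via w≈x x≈y z≈y = trans w≈x (trans x≈y (sym z≈y))

  homogeneousPart : (d : ℕ) → Submodule polyLeftModule ℓ
  homogeneousPart d = record
    { Member = Homogeneous d
    ; resp   = λ p≈q hp m m≢d → trans (sym (p≈q m)) (hp m m≢d)
    ; 0-mem  = λ _ _ → refl
    ; +-mem  = λ {p} {q} hp hq m m≢d →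
        trans (coeff-++ p q m) (trans (+-cong (hp m m≢d) (hq m m≢d)) (+-identityˡ 0#))
    ; *ₗ-mem = λ a {p} hp m m≢d →
        trans (coeff-· a p m) (trans (*-congˡ (hp m m≢d)) (zeroʳ a))
    }

  homogeneousLeftModule : (d : ℕ) → LeftModule ring (c ⊔ ℓ) ℓ
  homogeneousLeftModule d = subLeftModule polyLeftModule (homogeneousPart d)

  -- (G) ∩ S_d as a subspace of S_d.
  idealPart : ∀ {g} (G : Pred Poly g) (d : ℕ) →
              Submodule (homogeneousLeftModule d) (c ⊔ ℓ ⊔ g)
  idealPart G d = record
    { Member = Ideal G ∘ proj₁
    ; resp   = resp
    ; 0-mem  = nil
    ; +-mem  = add
    ; *ₗ-mem = λ a {(p , _)} p∈I →
        ≡.subst (Ideal G) (constant-*ₚ a p) (mul (constant a) p∈I)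
    }

------------------------------------------------------------------------
-- Subsets of projective space and their regularity index

module _ {c ℓ : Level} (K : CommutativeRing c ℓ) (isField : IsField K) where
  open CommutativeRing K
  open IsField isField

  NonZero : Pred Carrier ℓ
  NonZero x = ¬ (x ≈ 0#)

  record ProjectivePoint (s : ℕ) : Set (c ⊔ ℓ) where
    field
      coords  : Fin s → Carrier
      nonzero : ∃ λ i → NonZero (coords i)

  open ProjectivePoint

  _∼_ : ∀ {s} → Rel (Fin s → Carrier) (c ⊔ ℓ)
  x ∼ y = ∃ λ a → NonZero a × (∀ i → x i ≈ a * y i)

  inverse-nonZero : ∀ {a b} → b * a ≈ 1# → NonZero b
  inverse-nonZero ba≈1 b≈0 =
    1≉0 (trans (sym ba≈1) (trans (*-congʳ b≈0) (zeroˡ _)))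

  *-nonZero : ∀ {a b} → NonZero a → NonZero b → NonZero (a * b)
  *-nonZero {a} {b} a≉0 b≉0 ab≈0 = b≉0 (begin
    b               ≈⟨ *-identityˡ b ⟨
    1# * b          ≈⟨ *-congʳ (proj₁ (proj₂ a⁻¹)) ⟨
    a' * a * b      ≈⟨ *-assoc a' a b ⟩
    a' * (a * b)    ≈⟨ *-congˡ ab≈0 ⟩
    a' * 0#         ≈⟨ zeroʳ a' ⟩
    0#              ∎)
    where
    open Relation.Binary.Reasoning.Setoid setoid
    a⁻¹ = invertible a a≉0
    a' = proj₁ a⁻¹

  ∼-refl : ∀ {s} {x : Fin s → Carrier} → x ∼ x
  ∼-refl = 1# , 1≉0 , λ i → sym (*-identityˡ _)

  ∼-sym : ∀ {s} {x y : Fin s → Carrier} → x ∼ y → y ∼ x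
  ∼-sym {x = x} {y} (a , a≉0 , x≈ay) with invertible a a≉0
  ... | b , ba≈1 , _ = b , inverse-nonZero ba≈1 , λ i → sym (begin
    b * x i          ≈⟨ *-congˡ (x≈ay i) ⟩
    b * (a * y i)    ≈⟨ *-assoc b a (y i) ⟨
    b * a * y i      ≈⟨ *-congʳ ba≈1 ⟩
    1# * y i         ≈⟨ *-identityˡ (y i) ⟩
    y i              ∎)
    where open Relation.Binary.Reasoning.Setoid setoid

  ∼-trans : ∀ {s} {x y z : Fin s → Carrier} → x ∼ y → y ∼ z → x ∼ z
  ∼-trans (a , a≉0 , x≈ay) (b , b≉0 , y≈bz) =
    a * b , *-nonZero a≉0 b≉0 , λ i →
      trans (x≈ay i) (trans (*-congˡ (y≈bz i)) (sym (*-assoc a b _)))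

  module _ {s : ℕ} {p : Level} (X : Pred (ProjectivePoint s) p) where

    pointSetoid : Setoid (c ⊔ ℓ ⊔ p) (c ⊔ ℓ)
    pointSetoid = record
      { Carrier = ∃ X
      ; _≈_ = λ P Q → coords (proj₁ P) ∼ coords (proj₁ Q)
      ; isEquivalence = record { refl = ∼-refl ; sym = ∼-sym ; trans = ∼-trans }
      }

    HomogeneousVanishing : Pred (Poly K s) (c ⊔ ℓ ⊔ p)
    HomogeneousVanishing f =
      (∃ λ d → Homogeneous K s d f) × (∀ P → X P → eval K s f (coords P) ≈ 0#)

    -- S_d / (I_X ∩ S_d), where I_X is generated by the homogeneous
    -- polynomials vanishing on X.
    coordinateRingPart : (d : ℕ) → LeftModule ring (c ⊔ ℓ) (c ⊔ ℓ ⊔ p)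
    coordinateRingPart d = quotientLeftModule (homogeneousLeftModule K s d)
                                              (idealPart K s HomogeneousVanishing d)

    -- H_X(d) = h.
    HilbertFunction : ℕ → ℕ → Set (c ⊔ ℓ ⊔ p)
    HilbertFunction d h = HasDimension (coordinateRingPart d) h

    -- H_X(d) = |X|.
    HilbertFunctionIsCardinality : ℕ → Set (c ⊔ ℓ ⊔ p)
    HilbertFunctionIsCardinality d = ∃ λ h → HilbertFunction d h × HasCardinality pointSetoid h

    record IsRegularityIndex (d : ℕ) : Set (c ⊔ ℓ ⊔ p) where
      field
        attained : HilbertFunctionIsCardinality d
        least    : ∀ d₁ → HilbertFunctionIsCardinality d₁ → d ≤ d₁

  toricSet : ∀ {n s} → SimpleGraph n s → Pred (ProjectivePoint s) (c ⊔ ℓ)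
  toricSet {n} G P = ∃ λ (t : Fin n → Carrier) →
    (∀ j → NonZero (t j)) × (coords P ∼ λ e → t (src e) * t (tgt e))
    where open SimpleGraph G

{-# OPTIONS --safe #-}
-- Put N = q - 1 and r = q - 2.  Walking round the cycles gives a permutation
-- v ↦ next v of the vertices, a bijection v ↦ {v , next v} from vertices to
-- edges, and a 2-colouring flipped by next.  H_X(d) = |X| holds exactly when
-- every function on (representatives of) X is the value of a form of degree d.
--
-- Attained: on X the product of the x_e over the edges of one colour equals
-- the product over the other colour, and x^N = 1 for units.  So the exponent of
-- a monomial may be shifted by j + 1 on one colour and N - 1 - j on the other
-- and then reduced modulo N.  Averaged over j, the degree becomes k r, so for
-- some j it is at most k r; if the degree was congruent to r (k - 1) modulo N,
-- it is then at most r (k - 1), and can be padded to r (k - 1) by N-th powers.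
-- Hence only an indicator form of some degree congruent to r (k - 1) is needed:
-- x_0^d ∏_e (x_0^N - (x_e - (p_e / p_0) x_0)^N) for the point p.
--
-- Least: let g be a monomial of degree k + δ, δ < N, containing an edge at each
-- vertex of the first colour, with N ∣ d + k + δ.  If f of degree d agrees with
-- 1/g on X, then f g sums to N^n ≠ 0 over all unit vectors t.  But the sum of a
-- monomial in t vanishes unless N divides all its exponents, which are the
-- vertex degrees; adding them up over the first colour class gives
-- d + k + δ ≥ k N, that is d ≥ r (k - 1).
module Submission where

open import Defs
open import Level using (Level; _⊔_)
open import Algebra.Bundles using (CommutativeMonoid; CommutativeRing)
open import Algebra.Module.Bundles using (LeftModule)
import Algebra.Properties.CommutativeMonoid.Sum as CommutativeMonoidSum
import Algebra.Properties.CommutativeSemigroup as CommutativeSemigroupProperties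
import Algebra.Properties.CommutativeSemiring.Exp as Exp
import Algebra.Properties.Group as GroupProperties
import Algebra.Properties.Ring as RingProperties
import Algebra.Properties.Semiring.Sum as SemiringSum
import Algebra.Solver.Ring.NaturalCoefficients.Default as SemiringSolver
open import Data.Bool.Base using (Bool; true; false; not)
import Data.Bool.Properties as Bool
open import Data.Fin.Base using (Fin; zero; suc; toℕ; fromℕ<; punchOut; punchIn; opposite; inject≤; combine; funToFin; finToFun)
open import Data.Fin.Permutation as Perm using (Permutation; Permutation′; permutation; _⟨$⟩ʳ_; _⟨$⟩ˡ_; reverse)
import Data.Fin.Properties as Fin
open import Data.List.Base as List using (List; []; _∷_; _++_)
import Data.List.Properties as List
open import Data.List.Relation.Unary.All as All using (All; []; _∷_)
import Data.List.Relation.Unary.All.Properties as All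
open import Data.Nat.Base as ℕ using (ℕ; zero; suc)
import Data.Nat.Divisibility as ℕ
import Data.Nat.DivMod as ℕ
import Data.Nat.Properties as ℕ
open import Data.Nat.Tactic.RingSolver using (solve-∀)
open import Data.Product.Base using (∃; _×_; _,_; proj₁; proj₂)
open import Data.Sum.Base as Sum using (_⊎_; inj₁; inj₂)
open import Data.Vec.Base as Vec using (Vec; []; _∷_)
import Data.Vec.Functional as VecF
import Data.Vec.Properties as Vec
open import Function.Base using (_∘_)
open import Function.Bundles using (Inverse; Equivalence)
open import Function.Definitions using (Injective)
open import Relation.Binary.Bundles using (Setoid)
import Relation.Binary.Construct.Closure.ReflexiveTransitive as Star
open import Relation.Binary.Definitions using (Decidable)
open import Relation.Binary.PropositionalEquality as ≡ using (_≡_; _≢_)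
import Relation.Binary.Reasoning.Setoid as SetoidReasoning
open import Relation.Nullary using (¬_; yes; no; contradiction; ¬?; map′; decidable-stable)
open import Relation.Unary using (Pred)
import Relation.Unary as Unary

-- Finite sets and sums of natural numbers

module Σℕ = SemiringSum ℕ.+-*-semiring

-- If `y` were missed, punching it out of the codomain would inject `Fin (suc n)` into `Fin n`.
injective⇒surjective : ∀ {n} {f : Fin n → Fin n} → Injective _≡_ _≡_ f → ∀ y → ∃ λ x → f x ≡ y
injective⇒surjective {suc n} {f} f-inj y with Fin.any? (λ x → f x Fin.≟ y)
... | yes hit = hit
... | no miss = contradiction (Fin.injective⇒≤ g-inj) ℕ.1+n≰n
  where
  y≢f : ∀ x → y ≢ f x
  y≢f x y≡fx = miss (x , ≡.sym y≡fx)

  g-inj : Injective _≡_ _≡_ (λ x → punchOut (y≢f x))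
  g-inj eq = f-inj (Fin.punchOut-injective (y≢f _) (y≢f _) eq)

injective⇒permutation : ∀ {n} (f : Fin n → Fin n) → Injective _≡_ _≡_ f → Permutation′ n
injective⇒permutation f f-inj = permutation f (λ y → proj₁ (surj y))
  (λ y → proj₂ (surj y)) (λ x → f-inj (proj₂ (surj (f x))))
  where
  surj = injective⇒surjective f-inj

module _ {a ℓ : Level} (A : Setoid a ℓ) (_≈?_ : Decidable (Setoid._≈_ A)) where
  open Setoid A

  distinctRepresentatives : ∀ {n} (f : Fin n → Carrier) →
    ∃ λ h → ∃ λ (g : Fin h → Carrier) →
      (∀ {i j} → g i ≈ g j → i ≡ j) × (∀ i → ∃ λ j → f i ≈ g j)
  distinctRepresentatives {zero} f = 0 , (λ ()) , (λ { {()} }) , λ ()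
  distinctRepresentatives {suc n} f with distinctRepresentatives (f ∘ suc)
  ... | h , g , g-inj , g-covers with Fin.any? (λ j → f zero ≈? g j)
  ... | yes old = h , g , g-inj , λ { zero → old ; (suc i) → g-covers i }
  ... | no new = suc h , g′ , g′-inj , g′-covers
    where
    g′ : Fin (suc h) → Carrier
    g′ zero    = f zero
    g′ (suc j) = g j

    g′-inj : ∀ {i j} → g′ i ≈ g′ j → i ≡ j
    g′-inj {zero}  {zero}  _  = ≡.refl
    g′-inj {zero}  {suc j} eq = contradiction (j , eq) new
    g′-inj {suc i} {zero}  eq = contradiction (i , sym eq) new
    g′-inj {suc i} {suc j} eq = ≡.cong suc (g-inj eq)

    g′-covers : ∀ i → ∃ λ j → f i ≈ g′ j
    g′-covers zero    = zero , refl
    g′-covers (suc i) = suc (proj₁ (g-covers i)) , proj₂ (g-covers i)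

  -- Meant for `X`, which is covered by finitely many parameter vectors with many of them giving the
  -- same projective point; deciding `≈` makes it possible to discard repetitions.
  finitelyCovered⇒hasCardinality : ∀ {n} (f : Fin n → Carrier) → (∀ x → ∃ λ i → x ≈ f i) →
                                   ∃ (HasCardinality A)
  finitelyCovered⇒hasCardinality f f-covers with distinctRepresentatives f
  ... | h , g , g-inj , g-covers = h , record
    { to        = to
    ; from      = g
    ; to-cong   = λ {x} {y} x≈y → g-inj (trans (sym (x≈g[to] x)) (trans x≈y (x≈g[to] y)))
    ; from-cong = λ { ≡.refl → refl }
    ; inverse   = (λ {i} {y} y≈gi → g-inj (trans (sym (x≈g[to] y)) y≈gi))
                , (λ { {x} ≡.refl → sym (x≈g[to] x) })
    }
    where
    to : Carrier → Fin h
    to x = proj₁ (g-covers (proj₁ (f-covers x)))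

    x≈g[to] : ∀ x → x ≈ g (to x)
    x≈g[to] x = trans (proj₂ (f-covers x)) (proj₂ (g-covers (proj₁ (f-covers x))))

-- Averages and residues of sums of natural numbers.

module _ where
  open import Data.Nat.Base using (_+_; _*_; _∸_; _≤_; _<_; z≤n; s≤s; _%_; _/_)
  open Σℕ using (sum; sum-cong-≗; sum-permute; ∑-comm; ∑-distrib-+)

  sum-mono-≤ : ∀ {n} {f g : Fin n → ℕ} → (∀ i → f i ≤ g i) → sum f ≤ sum g
  sum-mono-≤ {zero}  f≤g = z≤n
  sum-mono-≤ {suc n} f≤g = ℕ.+-mono-≤ (f≤g zero) (sum-mono-≤ (f≤g ∘ suc))

  sum-const : ∀ n c → sum {n} (λ _ → c) ≡ n * c
  sum-const zero    c = ≡.refl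
  sum-const (suc n) c = ≡.cong (c +_) (sum-const n c)

  ∃≤average : ∀ {n} (w : Fin (suc n) → ℕ) b → sum w ≡ suc n * b → ∃ λ j → w j ≤ b
  ∃≤average {n} w b Σw≡nb with Fin.any? (λ j → w j ℕ.≤? b)
  ... | yes found = found
  ... | no none = contradiction Σw≡nb (ℕ.<⇒≢ nb<Σw ∘ ≡.sym)
    where
    nb<Σw : suc n * b < sum w
    nb<Σw = begin-strict
      suc n * b                  <⟨ ℕ.*-monoʳ-< (suc n) (ℕ.n<1+n b) ⟩
      suc n * suc b              ≡⟨ sum-const (suc n) (suc b) ⟨
      sum {suc n} (λ _ → suc b)  ≤⟨ sum-mono-≤ (λ j → ℕ.≰⇒> (λ wj≤b → none (j , wj≤b))) ⟩
      sum w                      ∎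
      where open ℕ.≤-Reasoning

  sum-% : ∀ {s} N .{{_ : ℕ.NonZero N}} (f : Fin s → ℕ) → sum (λ i → f i % N) % N ≡ sum f % N
  sum-% {zero}  N f = ≡.refl
  sum-% {suc s} N f = begin
    (f zero % N + sum (λ i → f (suc i) % N)) % N            ≡⟨ ℕ.%-distribˡ-+ (f zero % N) _ N ⟩
    (f zero % N % N + sum (λ i → f (suc i) % N) % N) % N    ≡⟨ ≡.cong₂ (λ x y → (x + y) % N) (ℕ.m%n%n≡m%n (f zero) N) (sum-% N (f ∘ suc)) ⟩
    (f zero % N + sum (f ∘ suc) % N) % N                    ≡⟨ ℕ.%-distribˡ-+ (f zero) _ N ⟨
    (f zero + sum (f ∘ suc)) % N                            ∎
    where open ≡.≡-Reasoning

  -- Both sides are the sum of `h 0` up to `h N`, with the first or the last term split off.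
  sum-telescope : ∀ N (h : ℕ → ℕ) →
    h 0 + sum {N} (λ j → h (suc (toℕ j))) ≡ sum {N} (h ∘ toℕ) + h N
  sum-telescope zero    h = ℕ.+-identityʳ (h 0)
  sum-telescope (suc N) h = ≡.trans (≡.cong (h 0 +_) (sum-telescope N (h ∘ suc)))
                                    (≡.sym (ℕ.+-assoc (h 0) _ _))

  -- Passing from `c` to `suc c` replaces the summand `c % N` by `(c + N) % N`, which is the same
  -- number.
  sum-rotate : ∀ N .{{_ : ℕ.NonZero N}} c → sum {N} (λ j → (c + toℕ j) % N) ≡ sum {N} toℕ
  sum-rotate N zero    = sum-cong-≗ (λ j → ℕ.m<n⇒m%n≡m (Fin.toℕ<n j))
  sum-rotate N (suc c) = ≡.trans
    (ℕ.+-cancelˡ-≡ ((c + 0) % N) _ _ (begin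
      (c + 0) % N + sum {N} (λ j → (suc c + toℕ j) % N)  ≡⟨ ≡.cong ((c + 0) % N +_) (sum-cong-≗ {N} (λ j → ≡.cong (_% N) (≡.sym (ℕ.+-suc c (toℕ j))))) ⟩
      (c + 0) % N + sum {N} (λ j → (c + suc (toℕ j)) % N)    ≡⟨ sum-telescope N (λ i → (c + i) % N) ⟩
      sum {N} (λ j → (c + toℕ j) % N) + (c + N) % N          ≡⟨ ≡.cong (sum {N} (λ j → (c + toℕ j) % N) +_) (≡.trans (ℕ.[m+n]%n≡m%n c N) (≡.cong (_% N) (≡.sym (ℕ.+-identityʳ c)))) ⟩
      sum {N} (λ j → (c + toℕ j) % N) + (c + 0) % N          ≡⟨ ℕ.+-comm _ ((c + 0) % N) ⟩
      (c + 0) % N + sum {N} (λ j → (c + toℕ j) % N)          ∎))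
    (sum-rotate N c)
    where open ≡.≡-Reasoning

  suc[toℕ]+opposite : ∀ {N} (j : Fin N) → suc (toℕ j) + toℕ (opposite j) ≡ N
  suc[toℕ]+opposite j = ≡.trans (≡.cong (suc (toℕ j) +_) (Fin.opposite-prop j))
                                (ℕ.m+[n∸m]≡n (Fin.toℕ<n j))

  -- Gauss's pairing of `j` with `opposite j`; the doubled form avoids division by 2.
  2*sum-toℕ : ∀ r → 2 * sum {suc r} toℕ ≡ suc r * r
  2*sum-toℕ r = begin
    2 * S                                                 ≡⟨ ≡.cong (S +_) (ℕ.+-identityʳ S) ⟩
    S + S                                                 ≡⟨ ≡.cong (S +_) (sum-permute {suc r} toℕ reverse) ⟩
    S + sum {suc r} (toℕ ∘ opposite)                      ≡⟨ ∑-distrib-+ {suc r} toℕ (toℕ ∘ opposite) ⟨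
    sum {suc r} (λ j → toℕ j + toℕ (opposite j))          ≡⟨ sum-cong-≗ {suc r} (λ j → ℕ.suc-injective (suc[toℕ]+opposite j)) ⟩
    sum {suc r} (λ _ → r)                                 ≡⟨ sum-const (suc r) r ⟩
    suc r * r                                             ∎
    where
    open ≡.≡-Reasoning
    S = sum {suc r} toℕ

  -- The two shifts add up to N, i.e. they are opposite modulo N.
  shift : ∀ {N} → Bool → Fin N → ℕ
  shift true  j = suc (toℕ j)
  shift false j = toℕ (opposite j)

  -- For either colour, the shifted values run through all residues modulo `suc r` once, in
  -- increasing or in decreasing order. Hence the total depends neither on `b` nor on `c`.
  sum-shift : ∀ r b c → sum {suc r} (λ j → (c + shift b j) % suc r) ≡ sum {suc r} toℕ
  sum-shift r true  c = ≡.trans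
    (sum-cong-≗ {suc r} (λ j → ≡.cong (_% suc r) (ℕ.+-suc c (toℕ j)))) (sum-rotate (suc r) (suc c))
  sum-shift r false c = ≡.trans
    (≡.sym (sum-permute {suc r} (λ j → (c + toℕ j) % suc r) reverse)) (sum-rotate (suc r) c)

  -- Exchanging the sums, each of the `2 * k` positions contributes `0 + 1 + ... + r` over all `j`.
  -- So the average over the `suc r` shifts is exactly `k * r`, and some shift does not exceed it.
  ∃light-shift : ∀ {s} r k (ε : Fin s → Bool) (a : Fin s → ℕ) → s ≡ 2 * k →
    ∃ λ (j : Fin (suc r)) → sum (λ e → (a e + shift (ε e) j) % suc r) ≤ k * r
  ∃light-shift {s} r k ε a s≡2k = ∃≤average _ (k * r) (begin
    sum (λ j → sum (λ e → (a e + shift (ε e) j) % suc r))  ≡⟨ ∑-comm {suc r} {s} (λ j e → (a e + shift (ε e) j) % suc r) ⟩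
    sum (λ e → sum (λ j → (a e + shift (ε e) j) % suc r))  ≡⟨ sum-cong-≗ {s} (λ e → sum-shift r (ε e) (a e)) ⟩
    sum {s} (λ _ → S)                                      ≡⟨ sum-const s S ⟩
    s * S                                                  ≡⟨ ≡.cong (_* S) (≡.trans s≡2k (ℕ.*-comm 2 k)) ⟩
    k * 2 * S                                              ≡⟨ ℕ.*-assoc k 2 S ⟩
    k * (2 * S)                                            ≡⟨ ≡.cong (k *_) (2*sum-toℕ r) ⟩
    k * (suc r * r)                                        ≡⟨ ℕ.*-assoc k (suc r) r ⟨
    k * suc r * r                                          ≡⟨ ≡.cong (_* r) (ℕ.*-comm k (suc r)) ⟩
    suc r * k * r                                          ≡⟨ ℕ.*-assoc (suc r) k r ⟩
    suc r * (k * r)                                        ∎)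
    where
    open ≡.≡-Reasoning
    S = sum {suc r} toℕ

  -- Congruent numbers differ by a multiple of `N`, so an excess of `w` over `d` would be at least
  -- `N`. The bound excludes this, and the quotients can be subtracted safely.
  %≡∧<⇒∃multiple : ∀ N .{{_ : ℕ.NonZero N}} w d → w % N ≡ d % N → w < N + d → ∃ λ y → w + y * N ≡ d
  %≡∧<⇒∃multiple N w d w%≡d% w<N+d = y , (begin
    w + y * N                           ≡⟨ ≡.cong (_+ y * N) (ℕ.m≡m%n+[m/n]*n w N) ⟩
    w % N + w / N * N + y * N           ≡⟨ ℕ.+-assoc (w % N) _ _ ⟩
    w % N + (w / N * N + y * N)         ≡⟨ ≡.cong₂ _+_ w%≡d% (≡.sym (ℕ.*-distribʳ-+ N (w / N) y)) ⟩
    d % N + (w / N + y) * N             ≡⟨ ≡.cong (λ x → d % N + x * N) (ℕ.m+[n∸m]≡n w/N≤d/N) ⟩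
    d % N + d / N * N                   ≡⟨ ℕ.m≡m%n+[m/n]*n d N ⟨
    d                                   ∎)
    where
    open ≡.≡-Reasoning
    y = d / N ∸ w / N

    w/N≤d/N : w / N ≤ d / N
    w/N≤d/N = ℕ.s≤s⁻¹ (ℕ.*-cancelʳ-< N (w / N) (suc (d / N)) (ℕ.+-cancelˡ-< (w % N) _ _
      (≡.subst₂ _<_ (ℕ.m≡m%n+[m/n]*n w N) (begin
        N + d                       ≡⟨ ≡.cong (N +_) (ℕ.m≡m%n+[m/n]*n d N) ⟩
        N + (d % N + d / N * N)     ≡⟨ ℕ.+-assoc N (d % N) _ ⟨
        N + d % N + d / N * N       ≡⟨ ≡.cong (_+ d / N * N) (ℕ.+-comm N (d % N)) ⟩
        d % N + N + d / N * N       ≡⟨ ℕ.+-assoc (d % N) N _ ⟩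
        d % N + (N + d / N * N)     ≡⟨ ≡.cong (_+ (N + d / N * N)) (≡.sym w%≡d%) ⟩
        w % N + (N + d / N * N)     ∎) w<N+d)))

  -- `δ` is the residue of `-x`. The strict bound is what the degree estimate needs later, hence the
  -- separate case of remainder 0, where `N ∸ 0` would be too large.
  ∃complement : ∀ N .{{_ : ℕ.NonZero N}} x → ∃ λ δ → δ < N × ∃ λ y → x + δ ≡ N * y
  ∃complement N x with x % N in eq
  ... | zero  = 0 , ℕ.>-nonZero⁻¹ N , x / N , (begin
    x + 0                ≡⟨ ℕ.+-identityʳ x ⟩
    x                    ≡⟨ ℕ.m≡m%n+[m/n]*n x N ⟩
    x % N + x / N * N    ≡⟨ ≡.cong (_+ x / N * N) eq ⟩
    x / N * N            ≡⟨ ℕ.*-comm (x / N) N ⟩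
    N * (x / N)          ∎)
    where open ≡.≡-Reasoning
  ... | suc ρ = N ∸ suc ρ , ℕ.∸-monoʳ-< (s≤s z≤n) sρ≤N , suc (x / N) , (begin
    x + (N ∸ suc ρ)                       ≡⟨ ≡.cong (_+ (N ∸ suc ρ)) (≡.trans (ℕ.m≡m%n+[m/n]*n x N) (≡.cong (_+ x / N * N) eq)) ⟩
    suc ρ + x / N * N + (N ∸ suc ρ)       ≡⟨ ≡.cong (_+ (N ∸ suc ρ)) (ℕ.+-comm (suc ρ) _) ⟩
    x / N * N + suc ρ + (N ∸ suc ρ)       ≡⟨ ℕ.+-assoc (x / N * N) _ _ ⟩
    x / N * N + (suc ρ + (N ∸ suc ρ))     ≡⟨ ≡.cong (x / N * N +_) (ℕ.m+[n∸m]≡n sρ≤N) ⟩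
    x / N * N + N                         ≡⟨ ℕ.+-comm _ N ⟩
    N + x / N * N                         ≡⟨ ℕ.*-comm (suc (x / N)) N ⟩
    N * suc (x / N)                       ∎)
    where
    open ≡.≡-Reasoning
    sρ≤N : suc ρ ≤ N
    sρ≤N = ℕ.<⇒≤ (≡.subst (_< N) eq (ℕ.m%n<n x N))

-- Finite fields

module FieldLemmas {c ℓ : Level} (K : CommutativeRing c ℓ) (isField : IsField K) where
  open CommutativeRing K hiding (zero) public
  open IsField isField public
  open Exp commutativeSemiring public
  open RingProperties ring using (-‿distribˡ-*; -‿distribʳ-*) public
  open GroupProperties +-group using () renaming (x∙y⁻¹≈ε⇒x≈y to x-y≈0⇒x≈y) public
  module Σ = SemiringSum semiring
  module Π = CommutativeMonoidSum *-commutativeMonoid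
  open Σ using (sum) public
  open Π using () renaming (sum to product) public
  open SetoidReasoning setoid

  private module S = SemiringSolver commutativeSemiring

  x≈y⇒x-y≈0 : ∀ {x y} → x ≈ y → x - y ≈ 0#
  x≈y⇒x-y≈0 {x} {y} x≈y = trans (+-congʳ x≈y) (-‿inverseʳ y)

  x*y≈0⇒y≈0 : ∀ {x y} → NonZero K isField x → x * y ≈ 0# → y ≈ 0#
  x*y≈0⇒y≈0 {x} {y} x≉0 xy≈0 with invertible x x≉0
  ... | x⁻¹ , x⁻¹x≈1 , _ = begin
    y               ≈⟨ *-identityˡ y ⟨
    1# * y          ≈⟨ *-congʳ x⁻¹x≈1 ⟨
    x⁻¹ * x * y     ≈⟨ *-assoc _ _ _ ⟩
    x⁻¹ * (x * y)   ≈⟨ *-congˡ xy≈0 ⟩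
    x⁻¹ * 0#        ≈⟨ zeroʳ _ ⟩
    0#              ∎

  *-cancelˡ-nonZero : ∀ {x y z} → NonZero K isField x → x * y ≈ x * z → y ≈ z
  *-cancelˡ-nonZero {x} {y} {z} x≉0 xy≈xz = x-y≈0⇒x≈y _ _ (x*y≈0⇒y≈0 x≉0 (begin
    x * (y - z)          ≈⟨ distribˡ x y (- z) ⟩
    x * y + x * - z      ≈⟨ +-congˡ (-‿distribʳ-* x z) ⟨
    x * y - x * z        ≈⟨ x≈y⇒x-y≈0 xy≈xz ⟩
    0#                   ∎))

  ^-nonZero : ∀ {x} n → NonZero K isField x → NonZero K isField (x ^ n)
  ^-nonZero zero    x≉0 = 1≉0
  ^-nonZero (suc n) x≉0 = *-nonZero K isField x≉0 (^-nonZero n x≉0)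

  product-nonZero : ∀ {n} {f : Fin n → Carrier} → (∀ i → NonZero K isField (f i)) →
                    NonZero K isField (product f)
  product-nonZero {zero}  f≉0 = 1≉0
  product-nonZero {suc n} f≉0 = *-nonZero K isField (f≉0 zero) (product-nonZero (f≉0 ∘ suc))

  product-zero : ∀ {n} (f : Fin n → Carrier) i → f i ≈ 0# → product f ≈ 0#
  product-zero {suc n} f zero    fi≈0 = trans (*-congʳ fi≈0) (zeroˡ _)
  product-zero {suc n} f (suc i) fi≈0 = trans (*-congˡ (product-zero (f ∘ suc) i fi≈0)) (zeroʳ _)

  sum-zero : ∀ {n} (f : Fin n → Carrier) → (∀ i → f i ≈ 0#) → sum f ≈ 0#
  sum-zero {n} f f≈0 = trans (Σ.sum-cong-≋ f≈0) (Σ.sum-replicate-zero n)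

  sum-single : ∀ {n} (f : Fin n → Carrier) i → (∀ j → j ≢ i → f j ≈ 0#) → sum f ≈ f i
  sum-single {suc n} f i f≈0 = trans (Σ.sum-remove {i = i} f)
    (trans (+-congˡ (sum-zero _ (λ j → f≈0 (punchIn i j) (Fin.punchInᵢ≢i i j)))) (+-identityʳ _))

  1^n≈1 : ∀ n → 1# ^ n ≈ 1#
  1^n≈1 zero    = refl
  1^n≈1 (suc n) = trans (*-identityˡ _) (1^n≈1 n)

  -- Horner form of a monic polynomial; the leading coefficient is implicit.
  monic : ∀ {d} → Vec Carrier d → Carrier → Carrier
  monic []       x = 1#
  monic (a ∷ as) x = x * monic as x + a

  x-y+y≈x : ∀ x y → x ≈ (x - y) + y
  x-y+y≈x x y = sym (trans (+-assoc x (- y) y) (trans (+-congˡ (-‿inverseˡ y)) (+-identityʳ x)))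

  -- Synthetic division: the intermediate Horner values at `α` are the coefficients of the quotient,
  -- and the last one is the remainder.
  monic-quotient : ∀ {d} (as : Vec Carrier (suc d)) α → ∃ λ (bs : Vec Carrier d) →
                   ∀ x → monic as x ≈ (x - α) * monic bs x + monic as α
  monic-quotient (a ∷ []) α = [] , λ x → trans (+-congʳ (*-congʳ (x-y+y≈x x α)))
    (S.solve 3 (λ y α a → let open S in ((y :+ α) :* con 1 :+ a) := (y :* con 1 :+ (α :* con 1 :+ a)))
      refl (x - α) α a)
  monic-quotient (a ∷ as@(_ ∷ _)) α with monic-quotient as α
  ... | bs , as≈ = monic as α ∷ bs , λ x → begin
    x * monic as x + a
      ≈⟨ +-congʳ (*-cong (x-y+y≈x x α) (as≈ x)) ⟩
    ((x - α) + α) * ((x - α) * monic bs x + monic as α) + a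
      ≈⟨ S.solve 5 (λ y α a g h → let open S in
           ((y :+ α) :* (y :* h :+ g) :+ a) := (y :* ((y :+ α) :* h :+ g) :+ (α :* g :+ a)))
           refl (x - α) α a (monic as α) (monic bs x) ⟩
    (x - α) * (((x - α) + α) * monic bs x + monic as α) + (α * monic as α + a)
      ≈⟨ +-congʳ (*-congˡ (+-congʳ (*-congʳ (x-y+y≈x x α)))) ⟨
    (x - α) * (x * monic bs x + monic as α) + (α * monic as α + a)
      ∎

  -- Dividing by `x - ρ zero` leaves a monic quotient of degree one less, and the other `ρ i` are
  -- roots of it because `ρ i - ρ zero` is nonzero. In degree 0 the polynomial is the constant 1.
  monic-rootBound : ∀ {d} (as : Vec Carrier d) (ρ : Fin (suc d) → Carrier) →
                    (∀ {i j} → ρ i ≈ ρ j → i ≡ j) → ¬ (∀ i → monic as (ρ i) ≈ 0#)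
  monic-rootBound []          ρ ρ-inj roots = 1≉0 (roots zero)
  monic-rootBound as@(_ ∷ _) ρ ρ-inj roots with monic-quotient as (ρ zero)
  ... | bs , as≈ = monic-rootBound bs (ρ ∘ suc) (Fin.suc-injective ∘ ρ-inj) λ i →
    x*y≈0⇒y≈0 (λ ρᵢ-ρ₀≈0 → contradiction (ρ-inj (x-y≈0⇒x≈y _ _ ρᵢ-ρ₀≈0)) λ ()) (begin
      (ρ (suc i) - ρ zero) * monic bs (ρ (suc i))                          ≈⟨ +-identityʳ _ ⟨
      (ρ (suc i) - ρ zero) * monic bs (ρ (suc i)) + 0#                     ≈⟨ +-congˡ (roots zero) ⟨
      (ρ (suc i) - ρ zero) * monic bs (ρ (suc i)) + monic as (ρ zero)      ≈⟨ as≈ (ρ (suc i)) ⟨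
      monic as (ρ (suc i))                                                 ≈⟨ roots (suc i) ⟩
      0#                                                                   ∎)

  monic-zeros : ∀ n x → monic (Vec.replicate n 0#) x ≈ x ^ n
  monic-zeros zero    x = refl
  monic-zeros (suc n) x = trans (+-identityʳ _) (*-congˡ (monic-zeros n x))

-- Units and power sums of a finite field.

module FiniteField {c ℓ : Level} (K : CommutativeRing c ℓ) (isField : IsField K) (r : ℕ)
                   (card : HasCardinality (CommutativeRing.setoid K) (suc (suc r))) where
  open FieldLemmas K isField
  open Inverse card
  open SetoidReasoning setoid

  N : ℕ
  N = suc r

  to-injective : ∀ {x y} → to x ≡ to y → x ≈ y
  to-injective {x} {y} eq = trans (sym (strictlyInverseʳ x)) (trans (from-cong eq) (strictlyInverseʳ y))

  from-injective : ∀ {i j} → from i ≈ from j → i ≡ j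
  from-injective {i} {j} eq = ≡.trans (≡.sym (strictlyInverseˡ i)) (≡.trans (to-cong eq) (strictlyInverseˡ j))

  infix 4 _≟_
  _≟_ : Decidable _≈_
  x ≟ y = map′ to-injective to-cong (to x Fin.≟ to y)

  -- Enumerates the nonzero elements: `punchIn` skips the index of zero.
  unit : Fin N → Carrier
  unit i = from (punchIn (to 0#) i)

  unit-nonZero : ∀ i → NonZero K isField (unit i)
  unit-nonZero i u≈0 = Fin.punchInᵢ≢i (to 0#) i (≡.trans (≡.sym (strictlyInverseˡ _)) (to-cong u≈0))

  unit-injective : ∀ {i j} → unit i ≈ unit j → i ≡ j
  unit-injective eq = Fin.punchIn-injective (to 0#) _ _ (from-injective eq)

  unitIndex : ∀ {x} → NonZero K isField x → ∃ λ i → unit i ≈ x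
  unitIndex {x} x≉0 = punchOut 0≢x ,
    trans (from-cong (Fin.punchIn-punchOut 0≢x)) (strictlyInverseʳ x)
    where
    0≢x : to 0# ≢ to x
    0≢x eq = x≉0 (to-injective (≡.sym eq))

  module _ {a b : Level} (M : CommutativeMonoid a b) where
    private
      module M = CommutativeMonoid M
      module ΣM = CommutativeMonoidSum M

    -- Multiplication by `x` permutes the units. The monoid is left general since the multiplicative
    -- one gives `x^N≈1` and the additive one the invariance of power sums.
    sum-units-* : ∀ {x} → NonZero K isField x →
                  (F : Carrier → M.Carrier) → (∀ {y z} → y ≈ z → F y M.≈ F z) →
                  ΣM.sum (F ∘ unit) M.≈ ΣM.sum (λ i → F (x * unit i))
    sum-units-* {x} x≉0 F F-cong = M.trans
      (ΣM.sum-permute (F ∘ unit) (injective⇒permutation σ σ-inj))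
      (ΣM.sum-cong-≋ (λ i → F-cong (unit-σ i)))
      where
      σ : Fin N → Fin N
      σ i = proj₁ (unitIndex (*-nonZero K isField x≉0 (unit-nonZero i)))

      unit-σ : ∀ i → unit (σ i) ≈ x * unit i
      unit-σ i = proj₂ (unitIndex (*-nonZero K isField x≉0 (unit-nonZero i)))

      σ-inj : ∀ {i j} → σ i ≡ σ j → i ≡ j
      σ-inj {i} {j} eq = unit-injective (*-cancelˡ-nonZero x≉0
        (trans (sym (unit-σ i)) (trans (reflexive (≡.cong unit eq)) (unit-σ j))))

  -- Multiplying every unit by `x` permutes them, so their product absorbs the factor `x ^ N`; it is
  -- nonzero and cancels.
  x^N≈1 : ∀ {x} → NonZero K isField x → x ^ N ≈ 1#
  x^N≈1 {x} x≉0 = *-cancelˡ-nonZero (product-nonZero unit-nonZero) (begin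
    product unit * x ^ N                    ≈⟨ *-comm _ _ ⟩
    x ^ N * product unit                    ≈⟨ *-congʳ (Π.sum-replicate N) ⟨
    product {N} (λ _ → x) * product unit    ≈⟨ Π.∑-distrib-+ (λ _ → x) unit ⟨
    product (λ i → x * unit i)              ≈⟨ sum-units-* *-commutativeMonoid x≉0 (λ y → y) (λ y≈z → y≈z) ⟨
    product unit                            ≈⟨ *-identityʳ _ ⟨
    product unit * 1#                       ∎)

  -- The sum of `q = suc N` ones is zero, so if `N` ones also summed to zero, then 1 would be zero.
  sum-ones-nonZero : NonZero K isField (sum {N} (λ _ → 1#))
  sum-ones-nonZero N≈0 = 1≉0 (begin
    1#                              ≈⟨ +-identityʳ 1# ⟨
    1# + 0#                         ≈⟨ +-congˡ N≈0 ⟨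
    sum {suc N} (λ _ → 1#)          ≈⟨ q≈0 ⟩
    0#                              ∎)
    where
    open GroupProperties +-group using (identityʳ-unique)

    σ-inj : ∀ {i j} → to (from i + 1#) ≡ to (from j + 1#) → i ≡ j
    σ-inj eq = from-injective (+-cancelʳ _ _ _ (to-injective eq))
      where open GroupProperties +-group using () renaming (∙-cancelʳ to +-cancelʳ)

    -- Adding 1 permutes the field, so the sum of all its elements is unchanged when `q` ones are
    -- added to it.
    q≈0 : sum {suc N} (λ _ → 1#) ≈ 0#
    q≈0 = identityʳ-unique (sum from) _ (begin
      sum from + sum {suc N} (λ _ → 1#)             ≈⟨ Σ.∑-distrib-+ from (λ _ → 1#) ⟨
      sum (λ i → from i + 1#)                       ≈⟨ Σ.sum-cong-≋ (λ i → strictlyInverseʳ (from i + 1#)) ⟨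
      sum (λ i → from (to (from i + 1#)))           ≈⟨ Σ.sum-permute from (injective⇒permutation _ σ-inj) ⟨
      sum from                                      ∎)

  ^-% : ∀ {x} → NonZero K isField x → ∀ a → x ^ (a ℕ.% N) ≈ x ^ a
  ^-% {x} x≉0 a = sym (begin
    x ^ a                                         ≈⟨ ^-congʳ x (ℕ.m≡m%n+[m/n]*n a N) ⟩
    x ^ (a ℕ.% N ℕ.+ a ℕ./ N ℕ.* N)               ≈⟨ ^-homo-* x (a ℕ.% N) _ ⟩
    x ^ (a ℕ.% N) * x ^ (a ℕ./ N ℕ.* N)           ≈⟨ *-congˡ (^-assocʳ x (a ℕ./ N) N) ⟨
    x ^ (a ℕ.% N) * (x ^ (a ℕ./ N)) ^ N           ≈⟨ *-congˡ (x^N≈1 (^-nonZero (a ℕ./ N) x≉0)) ⟩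
    x ^ (a ℕ.% N) * 1#                            ≈⟨ *-identityʳ _ ⟩
    x ^ (a ℕ.% N)                                 ∎)

  powerSum : ℕ → Carrier
  powerSum a = sum (λ i → unit i ^ a)

  -- Otherwise `a % N` is some `suc b` below `N`, and `suc (suc b)` distinct units are roots of a
  -- polynomial of degree `suc b`.
  allUnitPowers≈1⇒N∣a : ∀ a → (∀ i → unit i ^ a ≈ 1#) → N ℕ.∣ a
  allUnitPowers≈1⇒N∣a a all with a ℕ.% N in eq
  ... | zero  = ℕ.m%n≡0⇒n∣m a N eq
  ... | suc b = contradiction roots (monic-rootBound as (λ i → unit (inject≤ i 1+b<N))
                  (λ {i} {j} e → Fin.inject≤-injective 1+b<N 1+b<N i j (unit-injective e)))
    where
    1+b<N : suc b ℕ.< N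
    1+b<N = ≡.subst (ℕ._< N) eq (ℕ.m%n<n a N)

    as : Vec Carrier (suc b)
    -- The Horner coefficients of `x ^ suc b - 1`.
    as = - 1# ∷ Vec.replicate b 0#

    roots : ∀ i → monic as (unit (inject≤ i 1+b<N)) ≈ 0#
    roots i = begin
      u * monic (Vec.replicate b 0#) u - 1#      ≈⟨ +-congʳ (*-congˡ (monic-zeros b u)) ⟩
      u ^ suc b - 1#                             ≈⟨ +-congʳ (^-congʳ u eq) ⟨
      u ^ (a ℕ.% N) - 1#                         ≈⟨ +-congʳ (^-% (unit-nonZero i′) a) ⟩
      u ^ a - 1#                                 ≈⟨ x≈y⇒x-y≈0 (all i′) ⟩
      0#                                         ∎
      where
      i′ = inject≤ i 1+b<N
      u = unit i′

  -- Some unit `u` has `u ^ a` different from 1. Replacing each unit by its multiple by `u` permutes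
  -- the summands and multiplies the sum by `u ^ a`, so the sum must be zero.
  powerSum-zero : ∀ a → ¬ (N ℕ.∣ a) → powerSum a ≈ 0#
  powerSum-zero a N∤a with Fin.any? (λ i → ¬? (unit i ^ a ≟ 1#))
  ... | no none = contradiction (allUnitPowers≈1⇒N∣a a
                    (λ i → decidable-stable (unit i ^ a ≟ 1#) (λ ≉1 → none (i , ≉1)))) N∤a
  ... | yes (i , uᵃ≉1) = x*y≈0⇒y≈0 (λ uᵃ-1≈0 → uᵃ≉1 (x-y≈0⇒x≈y _ _ uᵃ-1≈0)) (begin
    (u ^ a - 1#) * powerSum a                ≈⟨ distribʳ _ _ _ ⟩
    u ^ a * powerSum a + - 1# * powerSum a   ≈⟨ +-congˡ (trans (sym (-‿distribˡ-* 1# _)) (-‿cong (*-identityˡ _))) ⟩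
    u ^ a * powerSum a - powerSum a          ≈⟨ x≈y⇒x-y≈0 (sym invariant) ⟩
    0#                                       ∎)
    where
    u = unit i

    invariant : powerSum a ≈ u ^ a * powerSum a
    invariant = begin
      powerSum a                              ≈⟨ sum-units-* +-commutativeMonoid (unit-nonZero i) (_^ a) (^-congˡ a) ⟩
      sum (λ j → (u * unit j) ^ a)            ≈⟨ Σ.sum-cong-≋ (λ j → ^-distrib-* u (unit j) a) ⟩
      sum (λ j → u ^ a * unit j ^ a)          ≈⟨ Σ.*-distribˡ-sum (u ^ a) (λ j → unit j ^ a) ⟨
      u ^ a * powerSum a                      ∎

-- Monomials and polynomials

sum-zipWith-+ : ∀ {s} (e f : Vec ℕ s) → Vec.sum (Vec.zipWith ℕ._+_ e f) ≡ Vec.sum e ℕ.+ Vec.sum f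
sum-zipWith-+ []      []      = ≡.refl
sum-zipWith-+ (a ∷ e) (b ∷ f) = ≡.trans (≡.cong (a ℕ.+ b ℕ.+_) (sum-zipWith-+ e f))
                                        (interchange a b (Vec.sum e) (Vec.sum f))
  where open CommutativeSemigroupProperties ℕ.+-commutativeSemigroup using (interchange)

sum-lookup : ∀ {s} (e : Vec ℕ s) → Σℕ.sum (Vec.lookup e) ≡ Vec.sum e
sum-lookup []      = ≡.refl
sum-lookup (a ∷ e) = ≡.cong (a ℕ.+_) (sum-lookup e)

indicator : ∀ {s} → Fin s → Fin s → ℕ
indicator zero    zero    = 1
indicator zero    (suc _) = 0
indicator (suc _) zero    = 0
indicator (suc i) (suc j) = indicator i j

Σℕ-indicator : ∀ {s} (i : Fin s) → Σℕ.sum (indicator i) ≡ 1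
Σℕ-indicator {suc s} zero    = ≡.cong suc (Σℕ.sum-replicate-zero s)
Σℕ-indicator {suc s} (suc i) = Σℕ-indicator i

module Monomials {c ℓ : Level} (K : CommutativeRing c ℓ) (isField : IsField K) where
  open FieldLemmas K isField
  open SetoidReasoning setoid

  mono : ∀ {s} → (Fin s → Carrier) → (Fin s → ℕ) → Carrier
  mono x a = product (λ i → x i ^ a i)

  mono-cong : ∀ {s} {x y : Fin s → Carrier} {a b : Fin s → ℕ} →
              (∀ i → x i ≈ y i) → (∀ i → a i ≡ b i) → mono x a ≈ mono y b
  mono-cong x≈y a≡b = Π.sum-cong-≋ (λ i → ^-cong (x≈y i) (a≡b i))

  mono-+ : ∀ {s} (x : Fin s → Carrier) a b → mono x (λ i → a i ℕ.+ b i) ≈ mono x a * mono x b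
  mono-+ x a b = trans (Π.sum-cong-≋ (λ i → ^-homo-* (x i) (a i) (b i)))
                       (Π.∑-distrib-+ (λ i → x i ^ a i) (λ i → x i ^ b i))

  mono-* : ∀ {s} (x y : Fin s → Carrier) a → mono (λ i → x i * y i) a ≈ mono x a * mono y a
  mono-* x y a = trans (Π.sum-cong-≋ (λ i → ^-distrib-* (x i) (y i) (a i)))
                       (Π.∑-distrib-+ (λ i → x i ^ a i) (λ i → y i ^ a i))

  mono-const : ∀ {s} z (a : Fin s → ℕ) → mono (λ _ → z) a ≈ z ^ Σℕ.sum a
  mono-const {zero}  z a = refl
  mono-const {suc s} z a = trans (*-congˡ (mono-const z (a ∘ suc))) (sym (^-homo-* z (a zero) _))

  mono-scale : ∀ {s} z (x : Fin s → Carrier) a → mono (λ i → z * x i) a ≈ z ^ Σℕ.sum a * mono x a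
  mono-scale z x a = trans (mono-* (λ _ → z) x a) (*-congʳ (mono-const z a))

  mono-nonZero : ∀ {s} {x : Fin s → Carrier} a → (∀ i → NonZero K isField (x i)) →
                 NonZero K isField (mono x a)
  mono-nonZero a x≉0 = product-nonZero (λ i → ^-nonZero (a i) (x≉0 i))

  mono-indicator : ∀ {s} (x : Fin s → Carrier) i → mono x (indicator i) ≈ x i
  mono-indicator {suc s} x zero    = trans (*-cong (*-identityʳ _) (Π.sum-replicate-zero s)) (*-identityʳ _)
  mono-indicator {suc s} x (suc i) = trans (*-identityˡ _) (mono-indicator (x ∘ suc) i)

-- Evaluation and degree of polynomials given as lists of terms.

module Polynomials {c ℓ : Level} (K : CommutativeRing c ℓ) (isField : IsField K) (s : ℕ) where
  open FieldLemmas K isField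
  open Monomials K isField
  open SetoidReasoning setoid

  Point : Set c
  Point = Fin s → Carrier

  eval-congʳ : ∀ p {x y : Point} → (∀ i → x i ≈ y i) → eval K s p x ≈ eval K s p y
  eval-congʳ []            x≈y = refl
  eval-congʳ ((a , e) ∷ p) x≈y = +-cong (*-congˡ (mono-cong {a = Vec.lookup e} x≈y (λ _ → ≡.refl))) (eval-congʳ p x≈y)

  eval-++ : ∀ p q x → eval K s (p ++ q) x ≈ eval K s p x + eval K s q x
  eval-++ []      q x = sym (+-identityˡ _)
  eval-++ (t ∷ p) q x = trans (+-congˡ (eval-++ p q x)) (sym (+-assoc _ _ _))

  eval-· : ∀ a p x → eval K s (_·ₚ_ K s a p) x ≈ a * eval K s p x
  eval-· a []            x = sym (zeroʳ a)
  eval-· a ((b , e) ∷ p) x = trans (+-cong (*-assoc a b _) (eval-· a p x)) (sym (distribˡ a _ _))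

  eval-neg : ∀ p x → eval K s (-ₚ_ K s p) x ≈ - eval K s p x
  eval-neg []            x = sym -0#≈0#
    where open RingProperties ring using (-0#≈0#)
  eval-neg ((b , e) ∷ p) x = trans (+-cong (sym (-‿distribˡ-* b _)) (eval-neg p x)) (-‿+-comm _ _)
    where open RingProperties ring using (-‿+-comm)

  eval-shift : ∀ a e q x →
    eval K s (List.map (λ t → a * proj₁ t , Vec.zipWith ℕ._+_ e (proj₂ t)) q) x
      ≈ (a * mono x (Vec.lookup e)) * eval K s q x
  eval-shift a e []            x = sym (zeroʳ _)
  eval-shift a e ((b , f) ∷ q) x = begin
    a * b * mono x (Vec.lookup (Vec.zipWith ℕ._+_ e f)) + _    ≈⟨ +-cong (*-congˡ (mono-cong {x = x} (λ _ → refl) (λ i → Vec.lookup-zipWith ℕ._+_ i e f))) (eval-shift a e q x) ⟩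
    a * b * mono x (λ i → Vec.lookup e i ℕ.+ Vec.lookup f i) + a * E * Q  ≈⟨ +-congʳ (*-congˡ (mono-+ x (Vec.lookup e) (Vec.lookup f))) ⟩
    a * b * (E * F) + a * E * Q                                ≈⟨ +-congʳ (interchange a b E F) ⟩
    a * E * (b * F) + a * E * Q                                ≈⟨ distribˡ _ _ _ ⟨
    a * E * (b * F + Q)                                        ∎
    where
    open CommutativeSemigroupProperties *-commutativeSemigroup using (interchange)
    E = mono x (Vec.lookup e)
    F = mono x (Vec.lookup f)
    Q = eval K s q x

  eval-* : ∀ p q x → eval K s (_*ₚ_ K s p q) x ≈ eval K s p x * eval K s q x
  eval-* []            q x = sym (zeroˡ _)
  eval-* ((a , e) ∷ p) q x = begin
    eval K s (List.map _ q ++ _*ₚ_ K s p q) x                   ≈⟨ eval-++ (List.map _ q) (_*ₚ_ K s p q) x ⟩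
    eval K s (List.map _ q) x + eval K s (_*ₚ_ K s p q) x       ≈⟨ +-cong (eval-shift a e q x) (eval-* p q x) ⟩
    a * mono x (Vec.lookup e) * Q + eval K s p x * Q            ≈⟨ distribʳ _ _ _ ⟨
    (a * mono x (Vec.lookup e) + eval K s p x) * Q              ∎
    where Q = eval K s q x

  termCoeff-≢ : ∀ a e m → e ≢ m → termCoeff K s a e m ≈ 0#
  termCoeff-≢ a e m e≢m with _≟ᵉ_ K s e m
  ... | yes e≡m = contradiction e≡m e≢m
  ... | no _    = refl

  module _ {π : Level} {P : Pred (Exponent K s) π} (P? : Unary.Decidable P) where

    restrict : Poly K s → Poly K s
    restrict = List.filter (P? ∘ proj₂)

    coeff-restrict-∉ : ∀ p {m} → ¬ P m → coeff K s (restrict p) m ≈ 0#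
    coeff-restrict-∉ []            ¬Pm = refl
    coeff-restrict-∉ ((a , e) ∷ p) {m} ¬Pm with P? e
    ... | no _   = coeff-restrict-∉ p ¬Pm
    ... | yes Pe = trans (+-cong (termCoeff-≢ a e m (λ { ≡.refl → ¬Pm Pe })) (coeff-restrict-∉ p ¬Pm))
                         (+-identityˡ _)

    coeff-restrict-∈ : ∀ p {m} → P m → coeff K s (restrict p) m ≈ coeff K s p m
    coeff-restrict-∈ []            Pm = refl
    coeff-restrict-∈ ((a , e) ∷ p) {m} Pm with P? e
    ... | yes Pe = +-congˡ (coeff-restrict-∈ p Pm)
    ... | no ¬Pe = trans (coeff-restrict-∈ p Pm)
                     (sym (trans (+-congʳ (termCoeff-≢ a e m (λ { ≡.refl → ¬Pe Pm }))) (+-identityˡ _)))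

  _≢?_ : ∀ e → Unary.Decidable (e ≢_)
  e ≢? m = ¬? (_≟ᵉ_ K s e m)

  -- Terms with the same exponent may be scattered over the list; this gathers those of exponent `e`
  -- into a single one.
  eval-isolate : ∀ e p x → eval K s p x ≈ coeff K s p e * mono x (Vec.lookup e) + eval K s (restrict (e ≢?_) p) x
  eval-isolate e []            x = sym (trans (+-identityʳ _) (zeroˡ _))
  eval-isolate e ((a , f) ∷ p) x with _≟ᵉ_ K s e f | _≟ᵉ_ K s f e
  ... | yes ≡.refl | yes _   = begin
    a * E + eval K s p x                            ≈⟨ +-congˡ (eval-isolate e p x) ⟩
    a * E + (coeff K s p e * E + R)                 ≈⟨ +-assoc _ _ _ ⟨
    a * E + coeff K s p e * E + R                   ≈⟨ +-congʳ (distribʳ E a _) ⟨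
    (a + coeff K s p e) * E + R                     ∎
    where
    E = mono x (Vec.lookup e)
    R = eval K s (restrict (e ≢?_) p) x
  ... | no e≢f     | no _    = begin
    a * F + eval K s p x                            ≈⟨ +-congˡ (eval-isolate e p x) ⟩
    a * F + (coeff K s p e * E + R)                 ≈⟨ x∙yz≈y∙xz _ _ _ ⟩
    coeff K s p e * E + (a * F + R)                 ≈⟨ +-congʳ (*-congʳ (+-identityˡ _)) ⟨
    (0# + coeff K s p e) * E + (a * F + R)          ∎
    where
    open CommutativeSemigroupProperties
      (CommutativeMonoid.commutativeSemigroup +-commutativeMonoid) using (x∙yz≈y∙xz)
    E = mono x (Vec.lookup e)
    F = mono x (Vec.lookup f)
    R = eval K s (restrict (e ≢?_) p) x
  ... | yes e≡f    | no f≢e  = contradiction (≡.sym e≡f) f≢e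
  ... | no e≢f     | yes f≡e = contradiction (≡.sym f≡e) e≢f

  -- A list with zero coefficients may be nonempty, its terms cancelling. Removing all terms that
  -- share the exponent of the head shortens the list and keeps the coefficients zero. The bound `n`
  -- carries the recursion, as the filtered list is not a structural part of `p`.
  eval-zero : ∀ n p → List.length p ℕ.≤ n → (∀ m → coeff K s p m ≈ 0#) → ∀ x → eval K s p x ≈ 0#
  eval-zero n       []              _    _   x = refl
  eval-zero (suc n) p@((a , e) ∷ p′) |p|≤n p≈0 x = begin
    eval K s p x                                               ≈⟨ eval-isolate e p x ⟩
    coeff K s p e * mono x (Vec.lookup e) + eval K s R x       ≈⟨ +-cong (trans (*-congʳ (p≈0 e)) (zeroˡ _)) (eval-zero n R |R|≤n R≈0 x) ⟩
    0# + 0#                                                    ≈⟨ +-identityˡ 0# ⟩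
    0#                                                         ∎
    where
    R = restrict (e ≢?_) p

    |R|≤n : List.length R ℕ.≤ n
    |R|≤n with _≟ᵉ_ K s e e
    ... | yes _  = ℕ.≤-trans (List.length-filter ((e ≢?_) ∘ proj₂) p′) (ℕ.s≤s⁻¹ |p|≤n)
    ... | no e≢e = contradiction ≡.refl e≢e

    R≈0 : ∀ m → coeff K s R m ≈ 0#
    R≈0 m with _≟ᵉ_ K s e m
    ... | yes ≡.refl = coeff-restrict-∉ (e ≢?_) p (λ e≢e → e≢e ≡.refl)
    ... | no e≢m     = trans (coeff-restrict-∈ (e ≢?_) p e≢m) (p≈0 m)

  eval-cong : ∀ p q → _≈ₚ_ K s p q → ∀ x → eval K s p x ≈ eval K s q x
  eval-cong p q p≈q x = x-y≈0⇒x≈y _ _ (begin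
    eval K s p x - eval K s q x               ≈⟨ +-congˡ (eval-neg q x) ⟨
    eval K s p x + eval K s (-ₚ_ K s q) x     ≈⟨ eval-++ p (-ₚ_ K s q) x ⟨
    eval K s (p ++ -ₚ_ K s q) x               ≈⟨ eval-zero _ (p ++ -ₚ_ K s q) ℕ.≤-refl p-q≈0 x ⟩
    0#                                        ∎)
    where
    p-q≈0 : ∀ m → coeff K s (p ++ -ₚ_ K s q) m ≈ 0#
    p-q≈0 m = begin
      coeff K s (p ++ -ₚ_ K s q) m                  ≈⟨ coeff-++ K s p (-ₚ_ K s q) m ⟩
      coeff K s p m + coeff K s (-ₚ_ K s q) m       ≈⟨ +-congˡ (coeff-neg K s q m) ⟩
      coeff K s p m - coeff K s q m                 ≈⟨ x≈y⇒x-y≈0 (p≈q m) ⟩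
      0#                                            ∎

  -- A condition on the terms rather than on the coefficients, so that it is inherited by the tail
  -- of the list and allows termwise induction.
  TermsOfDegree : ℕ → Pred (Poly K s) c
  TermsOfDegree d = All (λ t → Vec.sum (proj₂ t) ≡ d)

  termsOfDegree⇒homogeneous : ∀ {d p} → TermsOfDegree d p → Homogeneous K s d p
  termsOfDegree⇒homogeneous []                         m m≢d = refl
  termsOfDegree⇒homogeneous {p = (a , e) ∷ _} (e≡d ∷ p≡d) m m≢d =
    trans (+-cong (termCoeff-≢ a e m (λ { ≡.refl → m≢d e≡d })) (termsOfDegree⇒homogeneous p≡d m m≢d))
          (+-identityˡ _)

  -- Terms of the wrong degree have total coefficient zero for each exponent, so filtering them out
  -- leaves all coefficients unchanged.
  homogeneous⇒termsOfDegree : ∀ {d} f → Homogeneous K s d f → ∃ λ p → TermsOfDegree d p × _≈ₚ_ K s f p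
  homogeneous⇒termsOfDegree {d} f f-hom = restrict deg? f , All.all-filter (deg? ∘ proj₂) f , f≈
    where
    deg? : Unary.Decidable (λ m → Vec.sum m ≡ d)
    deg? m = Vec.sum m ℕ.≟ d

    f≈ : _≈ₚ_ K s f (restrict deg? f)
    f≈ m with Vec.sum m ℕ.≟ d
    ... | yes m≡d = sym (coeff-restrict-∈ deg? f m≡d)
    ... | no m≢d  = trans (f-hom m m≢d) (sym (coeff-restrict-∉ deg? f m≢d))

  eval-termsOfDegree-scale : ∀ {d p} → TermsOfDegree d p → ∀ z x →
                             eval K s p (λ i → z * x i) ≈ z ^ d * eval K s p x
  eval-termsOfDegree-scale []                                z x = sym (zeroʳ _)
  eval-termsOfDegree-scale {d} {(a , e) ∷ p} (e≡d ∷ p≡d) z x = begin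
    a * mono (λ i → z * x i) (Vec.lookup e) + eval K s p (λ i → z * x i)   ≈⟨ +-cong (*-congˡ (mono-scale z x (Vec.lookup e))) (eval-termsOfDegree-scale p≡d z x) ⟩
    a * (z ^ Σℕ.sum (Vec.lookup e) * E) + z ^ d * eval K s p x             ≈⟨ +-congʳ (x∙yz≈y∙xz a _ E) ⟩
    z ^ Σℕ.sum (Vec.lookup e) * (a * E) + z ^ d * eval K s p x             ≈⟨ +-congʳ (*-congʳ (^-congʳ z (≡.trans (sum-lookup e) e≡d))) ⟩
    z ^ d * (a * E) + z ^ d * eval K s p x                                 ≈⟨ distribˡ _ _ _ ⟨
    z ^ d * (a * E + eval K s p x)                                         ∎
    where
    open CommutativeSemigroupProperties *-commutativeSemigroup using (x∙yz≈y∙xz)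
    E = mono x (Vec.lookup e)

  eval-homogeneous-scale : ∀ {d} f → Homogeneous K s d f → ∀ z x →
                           eval K s f (λ i → z * x i) ≈ z ^ d * eval K s f x
  eval-homogeneous-scale {d} f f-hom z x with homogeneous⇒termsOfDegree f f-hom
  ... | p , p≡d , f≈p = begin
    eval K s f (λ i → z * x i)    ≈⟨ eval-cong f p f≈p _ ⟩
    eval K s p (λ i → z * x i)    ≈⟨ eval-termsOfDegree-scale p≡d z x ⟩
    z ^ d * eval K s p x          ≈⟨ *-congˡ (eval-cong f p f≈p x) ⟨
    z ^ d * eval K s f x          ∎

  IsForm : ℕ → (Point → Carrier) → Set (c ⊔ ℓ)
  IsForm d F = ∃ λ p → TermsOfDegree d p × (∀ x → eval K s p x ≈ F x)

  monomial-form : ∀ (a : Fin s → ℕ) → IsForm (Σℕ.sum a) (λ x → mono x a)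
  monomial-form a = (1# , Vec.tabulate a) ∷ []
    , ≡.trans (≡.sym (sum-lookup (Vec.tabulate a))) (Σℕ.sum-cong-≗ (Vec.lookup∘tabulate a)) ∷ []
    , λ x → trans (+-identityʳ _) (trans (*-identityˡ _) (mono-cong {x = x} (λ _ → refl) (Vec.lookup∘tabulate a)))

  cong-form : ∀ {d F G} → (∀ x → F x ≈ G x) → IsForm d F → IsForm d G
  cong-form F≈G (p , p≡d , p≈F) = p , p≡d , λ x → trans (p≈F x) (F≈G x)

  +-form : ∀ {d F G} → IsForm d F → IsForm d G → IsForm d (λ x → F x + G x)
  +-form (p , p≡d , p≈F) (q , q≡d , q≈G) =
    p ++ q , All.++⁺ p≡d q≡d , λ x → trans (eval-++ p q x) (+-cong (p≈F x) (q≈G x))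

  ·-form : ∀ {d F} a → IsForm d F → IsForm d (λ x → a * F x)
  ·-form a (p , p≡d , p≈F) =
    _·ₚ_ K s a p , All.map⁺ p≡d , λ x → trans (eval-· a p x) (*-congˡ (p≈F x))

  *-termsOfDegree : ∀ {d₁ d₂ p q} → TermsOfDegree d₁ p → TermsOfDegree d₂ q →
                    TermsOfDegree (d₁ ℕ.+ d₂) (_*ₚ_ K s p q)
  *-termsOfDegree []          q≡d = []
  *-termsOfDegree {p = (a , e) ∷ p} (e≡d ∷ p≡d) q≡d = All.++⁺
    (All.map⁺ (All.map (λ {t} t≡d → ≡.trans (sum-zipWith-+ e (proj₂ t)) (≡.cong₂ ℕ._+_ e≡d t≡d)) q≡d))
    (*-termsOfDegree p≡d q≡d)

  *-form : ∀ {d₁ d₂ F G} → IsForm d₁ F → IsForm d₂ G → IsForm (d₁ ℕ.+ d₂) (λ x → F x * G x)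
  *-form (p , p≡d , p≈F) (q , q≡d , q≈G) =
    _*ₚ_ K s p q , *-termsOfDegree p≡d q≡d , λ x → trans (eval-* p q x) (*-cong (p≈F x) (q≈G x))

  one-form : IsForm 0 (λ _ → 1#)
  one-form = ≡.subst (λ d → IsForm d (λ _ → 1#)) (Σℕ.sum-replicate-zero s)
    (cong-form (λ x → Π.sum-replicate-zero s) (monomial-form (λ _ → 0)))

  ^-form : ∀ {d F} n → IsForm d F → IsForm (n ℕ.* d) (λ x → F x ^ n)
  ^-form zero    F-form = one-form
  ^-form (suc n) F-form = *-form F-form (^-form n F-form)

  product-form : ∀ {d n} {F : Fin n → Point → Carrier} → (∀ i → IsForm d (F i)) →
                 IsForm (n ℕ.* d) (λ x → product (λ i → F i x))
  product-form {n = zero}  F-form = one-form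
  product-form {n = suc n} F-form = *-form (F-form zero) (product-form (F-form ∘ suc))

  coordinate-form : ∀ i → IsForm 1 (λ x → x i)
  coordinate-form i = ≡.subst (λ d → IsForm d (λ x → x i)) (Σℕ-indicator i)
    (cong-form (λ x → mono-indicator x i) (monomial-form (indicator i)))

-- Interpolation

funToFin-cong : ∀ {m n} {f g : Fin m → Fin n} → (∀ i → f i ≡ g i) → funToFin f ≡ funToFin g
funToFin-cong {zero}  f≗g = ≡.refl
funToFin-cong {suc m} f≗g = ≡.cong₂ combine (f≗g zero) (funToFin-cong (f≗g ∘ suc))

module Interpolation {c ℓ : Level} (K : CommutativeRing c ℓ) (isField : IsField K) (r : ℕ)
                     (card : HasCardinality (CommutativeRing.setoid K) (suc (suc r)))
                     {s : ℕ} {p : Level} (X : Pred (ProjectivePoint K isField s) p) where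
  open FieldLemmas K isField
  open FiniteField K isField r card
  open Polynomials K isField s
  open ProjectivePoint
  open SetoidReasoning setoid
  private module K = Inverse card

  -- Counting takes the place of rank arguments: vectors over a finite field are encoded as numbers
  -- below `q ^ h`, where injective self-maps are surjective.
  injective⇒surjective-vectors : ∀ {h} (Φ : (Fin h → Carrier) → (Fin h → Carrier)) →
    (∀ {a b} → (∀ i → Φ a i ≈ Φ b i) → ∀ i → a i ≈ b i) →
    ∀ y → ∃ λ a → ∀ i → Φ a i ≈ y i
  injective⇒surjective-vectors {h} Φ Φ-inj y = decode n , encode-injective φn≡y
    where
    encode : (Fin h → Carrier) → Fin (suc (suc r) ℕ.^ h)
    encode a = funToFin (K.to ∘ a)

    encode-injective : ∀ {a b} → encode a ≡ encode b → ∀ i → a i ≈ b i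
    encode-injective {a} {b} eq i = to-injective (≡.trans (≡.sym (Fin.finToFun-funToFin (K.to ∘ a) i))
      (≡.trans (≡.cong (λ n → finToFun n i) eq) (Fin.finToFun-funToFin (K.to ∘ b) i)))

    decode : Fin (suc (suc r) ℕ.^ h) → (Fin h → Carrier)
    decode n = K.from ∘ finToFun n

    decode-injective : ∀ {m n} → (∀ i → decode m i ≈ decode n i) → m ≡ n
    decode-injective {m} {n} eq = ≡.trans (≡.sym (Fin.funToFin-finToFin {h} m))
      (≡.trans (funToFin-cong (λ i → from-injective (eq i))) (Fin.funToFin-finToFin {h} n))

    surjectivity : ∃ λ n → encode (Φ (decode n)) ≡ encode y
    surjectivity = injective⇒surjective (decode-injective ∘ Φ-inj ∘ encode-injective) (encode y)

    n = proj₁ surjectivity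
    φn≡y = proj₂ surjectivity

  ideal-vanishes : ∀ {f} → Ideal K s (HomogeneousVanishing K isField X) f →
                   ∀ P → X P → eval K s f (coords P) ≈ 0#
  ideal-vanishes (gen (_ , f-vanishes)) P P∈X = f-vanishes P P∈X
  ideal-vanishes (resp {f} {g} f≈g f∈I)   P P∈X = trans (sym (eval-cong f g f≈g _)) (ideal-vanishes f∈I P P∈X)
  ideal-vanishes nil                    P P∈X = refl
  ideal-vanishes (add {f} {g} f∈I g∈I)  P P∈X = trans (eval-++ f g _)
    (trans (+-cong (ideal-vanishes f∈I P P∈X) (ideal-vanishes g∈I P P∈X)) (+-identityˡ 0#))
  ideal-vanishes (mul f {g} g∈I)        P P∈X = trans (eval-* f g _)
    (trans (*-congˡ (ideal-vanishes g∈I P P∈X)) (zeroʳ _))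

  module _ (d : ℕ) where
    private
      M = coordinateRingPart K isField X d
      module M = LeftModule M

    eval-linearCombination : ∀ {h} a (b : Fin h → M.Carrierᴹ) x →
      eval K s (proj₁ (linearCombination M a b)) x ≈ sum (λ i → a i * eval K s (proj₁ (b i)) x)
    eval-linearCombination {zero}  a b x = refl
    eval-linearCombination {suc h} a b x = trans
      (eval-++ (_·ₚ_ K s (a zero) (proj₁ (b zero))) (proj₁ (linearCombination M (a ∘ suc) (b ∘ suc))) x)
      (+-cong (eval-· (a zero) (proj₁ (b zero)) x) (eval-linearCombination (a ∘ suc) (b ∘ suc) x))

    eval-difference : ∀ (f g : M.Carrierᴹ) x →
      eval K s (proj₁ (f M.+ᴹ M.-ᴹ g)) x ≈ eval K s (proj₁ f) x - eval K s (proj₁ g) x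
    eval-difference f g x = trans (eval-++ (proj₁ f) (-ₚ_ K s (proj₁ g)) x) (+-congˡ (eval-neg (proj₁ g) x))

    module _ {h : ℕ} (|X|≡h : HasCardinality (pointSetoid K isField X) h) where
      private module X = Inverse |X|≡h

      point : Fin h → Point
      point i = coords (proj₁ (X.from i))

      ≈ᴹ⇒eval≈ : ∀ (f g : M.Carrierᴹ) → f M.≈ᴹ g → ∀ i →
                 eval K s (proj₁ f) (point i) ≈ eval K s (proj₁ g) (point i)
      ≈ᴹ⇒eval≈ f g f≈g i = x-y≈0⇒x≈y _ _ (trans (sym (eval-difference f g (point i)))
        (ideal-vanishes f≈g (proj₁ (X.from i)) (proj₂ (X.from i))))

      -- The difference is homogeneous. It vanishes at one representative of each point, hence at
      -- all of them, because rescaling by `z` multiplies its value by the unit `z ^ d`. So it is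
      -- itself a generator of the ideal.
      eval≈⇒≈ᴹ : ∀ (f g : M.Carrierᴹ) →
                 (∀ i → eval K s (proj₁ f) (point i) ≈ eval K s (proj₁ g) (point i)) → f M.≈ᴹ g
      eval≈⇒≈ᴹ f g f≈g = gen ((d , proj₂ f-g) , vanishes)
        where
        f-g : M.Carrierᴹ
        f-g = f M.+ᴹ M.-ᴹ g

        vanishes : ∀ P → X P → eval K s (proj₁ f-g) (coords P) ≈ 0#
        vanishes P P∈X with X.strictlyInverseʳ (P , P∈X)
        ... | z , z≉0 , Pᵢ≈zP = x*y≈0⇒y≈0 (^-nonZero d z≉0) (begin
          z ^ d * eval K s (proj₁ f-g) (coords P)             ≈⟨ eval-homogeneous-scale (proj₁ f-g) (proj₂ f-g) z (coords P) ⟨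
          eval K s (proj₁ f-g) (λ j → z * coords P j)         ≈⟨ eval-congʳ (proj₁ f-g) Pᵢ≈zP ⟨
          eval K s (proj₁ f-g) (point i)                      ≈⟨ eval-difference f g (point i) ⟩
          _ - _                                               ≈⟨ x≈y⇒x-y≈0 (f≈g i) ⟩
          0#                                                  ∎)
          where i = X.to (P , P∈X)

      -- With as many basis elements as points, the map `Φ` from coefficients to values is a
      -- self-map of the vectors of length `h`. Independence makes it injective, hence surjective.
      interpolation : HilbertFunction K isField X d h → ∀ (y : Fin h → Carrier) →
                      ∃ λ f → Homogeneous K s d f × (∀ i → eval K s f (point i) ≈ y i)
      interpolation (b , b-basis) y = proj₁ f , proj₂ f , λ i → trans (eval-linearCombination a b (point i)) (Φa≈y i)
        where
        open IsBasis b-basis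

        Φ : (Fin h → Carrier) → (Fin h → Carrier)
        Φ a i = sum (λ j → a j * eval K s (proj₁ (b j)) (point i))

        Φ-inj : ∀ {a a′} → (∀ i → Φ a i ≈ Φ a′ i) → ∀ i → a i ≈ a′ i
        Φ-inj {a} {a′} Φa≈Φa′ i = x-y≈0⇒x≈y _ _ (independent (λ j → a j - a′ j)
          (eval≈⇒≈ᴹ (linearCombination M (λ j → a j - a′ j) b) M.0ᴹ λ i →
            trans (eval-linearCombination (λ j → a j - a′ j) b (point i)) (identityˡ-unique _ (Φ a′ i) (begin
              sum (λ j → (a j - a′ j) * v i j) + Φ a′ i              ≈⟨ Σ.∑-distrib-+ (λ j → (a j - a′ j) * v i j) (λ j → a′ j * v i j) ⟨
              sum (λ j → (a j - a′ j) * v i j + a′ j * v i j)        ≈⟨ Σ.sum-cong-≋ (λ j → trans (sym (distribʳ (v i j) _ _)) (*-congʳ (sym (x-y+y≈x (a j) (a′ j))))) ⟩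
              Φ a i                                                  ≈⟨ Φa≈Φa′ i ⟩
              Φ a′ i                                                 ∎))) i)
          where
          open GroupProperties +-group using (identityˡ-unique)

          v : Fin h → Fin h → Carrier
          v i j = eval K s (proj₁ (b j)) (point i)

        solution : ∃ λ a → ∀ i → Φ a i ≈ y i
        solution = injective⇒surjective-vectors Φ Φ-inj y

        a = proj₁ solution
        Φa≈y = proj₂ solution

        f : M.Carrierᴹ
        f = linearCombination M a b

      -- The indicator forms are dual to the points up to nonzero scalars, so the coefficient at `i`
      -- is the value at the `i`-th point divided by that scalar.
      indicators⇒basis : (∀ i → ∃ λ f → Homogeneous K s d f × NonZero K isField (eval K s f (point i)) ×
                                        (∀ j → j ≢ i → eval K s f (point j) ≈ 0#)) →
                         HilbertFunction K isField X d h
      indicators⇒basis ind = b , record { independent = independent ; spanning = spanning }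
        where
        b : Fin h → M.Carrierᴹ
        b i = proj₁ (ind i) , proj₁ (proj₂ (ind i))

        bᵢPᵢ : Fin h → Carrier
        bᵢPᵢ i = eval K s (proj₁ (b i)) (point i)

        bᵢPᵢ≉0 : ∀ i → NonZero K isField (bᵢPᵢ i)
        bᵢPᵢ≉0 i = proj₁ (proj₂ (proj₂ (ind i)))

        eval-combination : ∀ a i → eval K s (proj₁ (linearCombination M a b)) (point i) ≈ a i * bᵢPᵢ i
        eval-combination a i = trans (eval-linearCombination a b (point i))
          (sum-single _ i (λ j j≢i → trans (*-congˡ (proj₂ (proj₂ (proj₂ (ind j))) i (j≢i ∘ ≡.sym))) (zeroʳ _)))

        independent : ∀ a → linearCombination M a b M.≈ᴹ M.0ᴹ → ∀ i → a i ≈ 0#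
        independent a a≈0 i = x*y≈0⇒y≈0 (bᵢPᵢ≉0 i) (begin
          bᵢPᵢ i * a i                                               ≈⟨ *-comm _ _ ⟩
          a i * bᵢPᵢ i                                               ≈⟨ eval-combination a i ⟨
          eval K s (proj₁ (linearCombination M a b)) (point i)       ≈⟨ ≈ᴹ⇒eval≈ (linearCombination M a b) M.0ᴹ a≈0 i ⟩
          0#                                                         ∎)

        spanning : ∀ f → ∃ λ a → f M.≈ᴹ linearCombination M a b
        spanning f = a , eval≈⇒≈ᴹ f (linearCombination M a b) λ i → begin
          eval K s (proj₁ f) (point i)                              ≈⟨ *-identityʳ _ ⟨
          eval K s (proj₁ f) (point i) * 1#                         ≈⟨ *-congˡ (proj₁ (proj₂ (bᵢPᵢ⁻¹ i))) ⟨
          eval K s (proj₁ f) (point i) * (proj₁ (bᵢPᵢ⁻¹ i) * bᵢPᵢ i) ≈⟨ *-assoc _ _ _ ⟨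
          a i * bᵢPᵢ i                                              ≈⟨ eval-combination a i ⟨
          eval K s (proj₁ (linearCombination M a b)) (point i)      ∎
          where
          bᵢPᵢ⁻¹ = λ i → invertible (bᵢPᵢ i) (bᵢPᵢ≉0 i)

          a : Fin h → Carrier
          a i = eval K s (proj₁ f) (point i) * proj₁ (bᵢPᵢ⁻¹ i)

-- Toric sets of bipartite 2-regular graphs

-- Isolates the structure of the graph on which the computations with toric points rest. The graph
-- is a union of cycles walked through by `next`, and `colour-next` makes it bipartite.
record CyclicOrientation {n s : ℕ} (G : SimpleGraph n s) : Set where
  open SimpleGraph G
  field
    next        : Permutation′ n
    edge        : Permutation n s
    edge-joins  : ∀ v → Joins (edge ⟨$⟩ʳ v) v (next ⟨$⟩ʳ v)
    colour      : Fin n → Bool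
    colour-next : ∀ v → colour (next ⟨$⟩ʳ v) ≡ not (colour v)

  prev : Fin n → Fin n
  prev v = next ⟨$⟩ˡ v

  prev-next : ∀ v → prev (next ⟨$⟩ʳ v) ≡ v
  prev-next v = Perm.inverseˡ next

  next-prev : ∀ v → next ⟨$⟩ʳ prev v ≡ v
  next-prev v = Perm.inverseʳ next

  edgeColour : Fin s → Bool
  edgeColour e = colour (edge ⟨$⟩ˡ e)

  edgeColour-edge : ∀ v → edgeColour (edge ⟨$⟩ʳ v) ≡ colour v
  edgeColour-edge v = ≡.cong colour (Perm.inverseˡ edge)

  -- The edges at `v` are those leaving `v` and `prev v`. The value is the exponent of `t v` once
  -- the coordinates of a toric point are substituted into the monomial with exponents `a`.
  vertexDegree : (Fin s → ℕ) → Fin n → ℕ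
  vertexDegree a v = a (edge ⟨$⟩ʳ v) ℕ.+ a (edge ⟨$⟩ʳ prev v)

  private
    w-colour-next : ∀ (w : Bool → ℕ) v → w (colour v) ℕ.+ w (colour (next ⟨$⟩ʳ v)) ≡ w true ℕ.+ w false
    w-colour-next w v rewrite colour-next v with colour v
    ... | true  = ≡.refl
    ... | false = ℕ.+-comm (w false) (w true)

  -- Adding the sum to its copy reindexed by `next` gives `w true + w false` at every vertex, since
  -- neighbours have opposite colours.
  sum-colour : ∀ k → n ≡ 2 ℕ.* k → ∀ w → Σℕ.sum (w ∘ colour) ≡ k ℕ.* (w true ℕ.+ w false)
  sum-colour k n≡2k w = ℕ.*-cancelˡ-≡ _ _ 2 (begin
    2 ℕ.* S                                                           ≡⟨ ≡.cong (S ℕ.+_) (ℕ.+-identityʳ S) ⟩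
    S ℕ.+ S                                                           ≡⟨ ≡.cong (S ℕ.+_) (Σℕ.sum-permute (w ∘ colour) next) ⟩
    S ℕ.+ Σℕ.sum (λ v → w (colour (next ⟨$⟩ʳ v)))                     ≡⟨ Σℕ.∑-distrib-+ (w ∘ colour) _ ⟨
    Σℕ.sum (λ v → w (colour v) ℕ.+ w (colour (next ⟨$⟩ʳ v)))          ≡⟨ Σℕ.sum-cong-≗ (w-colour-next w) ⟩
    Σℕ.sum {n} (λ _ → w true ℕ.+ w false)                             ≡⟨ sum-const n _ ⟩
    n ℕ.* (w true ℕ.+ w false)                                        ≡⟨ ≡.cong (ℕ._* _) n≡2k ⟩
    2 ℕ.* k ℕ.* (w true ℕ.+ w false)                                  ≡⟨ ℕ.*-assoc 2 k _ ⟩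
    2 ℕ.* (k ℕ.* (w true ℕ.+ w false))                                ∎)
    where
    open ≡.≡-Reasoning
    S = Σℕ.sum (w ∘ colour)

  sum-edgeColour : ∀ k → n ≡ 2 ℕ.* k → ∀ w → Σℕ.sum (w ∘ edgeColour) ≡ k ℕ.* (w true ℕ.+ w false)
  sum-edgeColour k n≡2k w = ≡.trans (Σℕ.sum-permute (w ∘ edgeColour) edge)
    (≡.trans (Σℕ.sum-cong-≗ (≡.cong w ∘ edgeColour-edge)) (sum-colour k n≡2k w))

  vertexDegree-edgeColour : ∀ w v → vertexDegree (w ∘ edgeColour) v ≡ w true ℕ.+ w false
  vertexDegree-edgeColour w v = begin
    w (edgeColour (edge ⟨$⟩ʳ v)) ℕ.+ w (edgeColour (edge ⟨$⟩ʳ prev v))   ≡⟨ ≡.cong₂ (λ x y → w x ℕ.+ w y) (edgeColour-edge v) (edgeColour-edge (prev v)) ⟩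
    w (colour v) ℕ.+ w (colour (prev v))                                 ≡⟨ ℕ.+-comm (w (colour v)) _ ⟩
    w (colour (prev v)) ℕ.+ w (colour v)                                 ≡⟨ ≡.cong (λ u → w (colour (prev v)) ℕ.+ w (colour u)) (next-prev v) ⟨
    w (colour (prev v)) ℕ.+ w (colour (next ⟨$⟩ʳ prev v))                ≡⟨ w-colour-next w (prev v) ⟩
    w true ℕ.+ w false                                                   ∎
    where open ≡.≡-Reasoning

  mark : Bool → ℕ
  mark true  = 1
  mark false = 0

  -- Every edge has exactly one endpoint of colour true.
  sum-mark*vertexDegree : ∀ a → Σℕ.sum (λ v → mark (colour v) ℕ.* vertexDegree a v) ≡ Σℕ.sum a
  sum-mark*vertexDegree a = begin
    Σℕ.sum (λ v → m v ℕ.* vertexDegree a v)                        ≡⟨ Σℕ.sum-cong-≗ (λ v → ℕ.*-distribˡ-+ (m v) (a (edge ⟨$⟩ʳ v)) _) ⟩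
    Σℕ.sum (λ v → m v ℕ.* b v ℕ.+ m v ℕ.* b (prev v))              ≡⟨ Σℕ.∑-distrib-+ (λ v → m v ℕ.* b v) (λ v → m v ℕ.* b (prev v)) ⟩
    Σℕ.sum (λ v → m v ℕ.* b v) ℕ.+ Σℕ.sum (λ v → m v ℕ.* b (prev v)) ≡⟨ ≡.cong (Σℕ.sum (λ v → m v ℕ.* b v) ℕ.+_) (Σℕ.sum-permute (λ v → m v ℕ.* b (prev v)) next) ⟩
    Σℕ.sum (λ v → m v ℕ.* b v) ℕ.+ Σℕ.sum (λ v → m (next ⟨$⟩ʳ v) ℕ.* b (prev (next ⟨$⟩ʳ v))) ≡⟨ Σℕ.∑-distrib-+ (λ v → m v ℕ.* b v) (λ v → m (next ⟨$⟩ʳ v) ℕ.* b (prev (next ⟨$⟩ʳ v))) ⟨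
    Σℕ.sum (λ v → m v ℕ.* b v ℕ.+ m (next ⟨$⟩ʳ v) ℕ.* b (prev (next ⟨$⟩ʳ v))) ≡⟨ Σℕ.sum-cong-≗ split ⟩
    Σℕ.sum b                                                       ≡⟨ Σℕ.sum-permute a edge ⟨
    Σℕ.sum a                                                       ∎
    where
    open ≡.≡-Reasoning
    m : Fin n → ℕ
    m v = mark (colour v)

    b : Fin n → ℕ
    b v = a (edge ⟨$⟩ʳ v)

    split : ∀ v → m v ℕ.* b v ℕ.+ m (next ⟨$⟩ʳ v) ℕ.* b (prev (next ⟨$⟩ʳ v)) ≡ b v
    split v = begin
      m v ℕ.* b v ℕ.+ m (next ⟨$⟩ʳ v) ℕ.* b (prev (next ⟨$⟩ʳ v))    ≡⟨ ≡.cong (λ u → m v ℕ.* b v ℕ.+ m (next ⟨$⟩ʳ v) ℕ.* b u) (prev-next v) ⟩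
      m v ℕ.* b v ℕ.+ m (next ⟨$⟩ʳ v) ℕ.* b v                       ≡⟨ ℕ.*-distribʳ-+ (b v) (m v) _ ⟨
      (m v ℕ.+ m (next ⟨$⟩ʳ v)) ℕ.* b v                             ≡⟨ ≡.cong (ℕ._* b v) (w-colour-next mark v) ⟩
      1 ℕ.* b v                                                     ≡⟨ ℕ.*-identityˡ (b v) ⟩
      b v                                                           ∎

  -- The exponents of the monomial g in the proof of minimality.
  gaps : Fin s → ℕ → Fin s → ℕ
  gaps e₀ δ e = mark (edgeColour e) ℕ.+ δ ℕ.* indicator e₀ e

  sum-gaps : ∀ k → n ≡ 2 ℕ.* k → ∀ e₀ δ → Σℕ.sum (gaps e₀ δ) ≡ k ℕ.+ δ
  sum-gaps k n≡2k e₀ δ = ≡.trans (Σℕ.∑-distrib-+ (mark ∘ edgeColour) (λ e → δ ℕ.* indicator e₀ e))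
    (≡.cong₂ ℕ._+_ (≡.trans (sum-edgeColour k n≡2k mark) (ℕ.*-identityʳ _))
      (≡.trans (≡.sym (Σℕ.*-distribˡ-sum δ (indicator e₀)))
        (≡.trans (≡.cong (δ ℕ.*_) (Σℕ-indicator e₀)) (ℕ.*-identityʳ δ))))

  -- At a vertex of colour `true` the marked edge makes the degree positive, so divisibility forces
  -- it to be at least `N`. There are `k` such vertices, and summing their degrees counts each edge
  -- once.
  divisible-vertexDegrees : ∀ k → n ≡ 2 ℕ.* k → ∀ e₀ δ a N →
    (∀ v → N ℕ.∣ vertexDegree (λ e → a e ℕ.+ gaps e₀ δ e) v) → k ℕ.* N ℕ.≤ Σℕ.sum a ℕ.+ (k ℕ.+ δ)
  divisible-vertexDegrees k n≡2k e₀ δ a N N∣ = begin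
    k ℕ.* N                                                  ≡⟨ ≡.cong (k ℕ.*_) (≡.trans (ℕ.+-identityʳ (N ℕ.+ 0)) (ℕ.+-identityʳ N)) ⟨
    k ℕ.* (1 ℕ.* N ℕ.+ 0 ℕ.* N)                              ≡⟨ sum-colour k n≡2k (λ c → mark c ℕ.* N) ⟨
    Σℕ.sum (λ v → mark (colour v) ℕ.* N)                     ≤⟨ sum-mono-≤ (λ v → marked v (colour v) ≡.refl) ⟩
    Σℕ.sum (λ v → mark (colour v) ℕ.* vertexDegree b v)      ≡⟨ sum-mark*vertexDegree b ⟩
    Σℕ.sum b                                                 ≡⟨ Σℕ.∑-distrib-+ a (gaps e₀ δ) ⟩
    Σℕ.sum a ℕ.+ Σℕ.sum (gaps e₀ δ)                          ≡⟨ ≡.cong (Σℕ.sum a ℕ.+_) (sum-gaps k n≡2k e₀ δ) ⟩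
    Σℕ.sum a ℕ.+ (k ℕ.+ δ)                                   ∎
    where
    open ℕ.≤-Reasoning
    b : Fin s → ℕ
    b e = a e ℕ.+ gaps e₀ δ e

    positive : ∀ v → colour v ≡ true → 0 ℕ.< vertexDegree b v
    positive v v-true = begin
      1                                     ≡⟨ ≡.cong mark (≡.trans (edgeColour-edge v) v-true) ⟨
      mark (edgeColour (edge ⟨$⟩ʳ v))       ≤⟨ ℕ.m≤m+n _ _ ⟩
      gaps e₀ δ (edge ⟨$⟩ʳ v)               ≤⟨ ℕ.m≤n+m _ (a (edge ⟨$⟩ʳ v)) ⟩
      b (edge ⟨$⟩ʳ v)                       ≤⟨ ℕ.m≤m+n _ _ ⟩
      vertexDegree b v                      ∎

    marked : ∀ v c → colour v ≡ c → mark c ℕ.* N ℕ.≤ mark c ℕ.* vertexDegree b v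
    marked v false _      = ℕ.z≤n
    marked v true  v-true = ℕ.*-monoʳ-≤ 1 (ℕ.∣⇒≤ {{ℕ.>-nonZero (positive v v-true)}} (N∣ v))

-- The worst case is `δ = r`, where the claim follows by cancelling `suc k′ + r`.
k*N≤d+k+δ⇒r*k′≤d : ∀ r k′ d δ → δ ℕ.< suc r → suc k′ ℕ.* suc r ℕ.≤ d ℕ.+ (suc k′ ℕ.+ δ) → r ℕ.* k′ ℕ.≤ d
k*N≤d+k+δ⇒r*k′≤d r k′ d δ δ<N kN≤ = ℕ.+-cancelʳ-≤ (suc k′ ℕ.+ r) _ _ (begin
  r ℕ.* k′ ℕ.+ (suc k′ ℕ.+ r)     ≡⟨ rearrange r k′ ⟩
  suc k′ ℕ.* suc r                ≤⟨ kN≤ ⟩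
  d ℕ.+ (suc k′ ℕ.+ δ)            ≤⟨ ℕ.+-monoʳ-≤ d (ℕ.+-monoʳ-≤ (suc k′) (ℕ.s≤s⁻¹ δ<N)) ⟩
  d ℕ.+ (suc k′ ℕ.+ r)            ∎)
  where
  open ℕ.≤-Reasoning
  rearrange : ∀ r k → r ℕ.* k ℕ.+ (suc k ℕ.+ r) ≡ suc k ℕ.* suc r
  rearrange = solve-∀

-- Sums over all vectors of units.

module UnitSums {c ℓ : Level} (K : CommutativeRing c ℓ) (isField : IsField K) (r : ℕ)
                (card : HasCardinality (CommutativeRing.setoid K) (suc (suc r))) where
  open FieldLemmas K isField
  open FiniteField K isField r card
  open Monomials K isField
  open SetoidReasoning setoid

  ∑units : ∀ n → ((Fin n → Carrier) → Carrier) → Carrier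
  ∑units zero    F = F (λ ())
  ∑units (suc n) F = sum (λ i → ∑units n (λ t → F (unit i VecF.∷ t)))

  ∑units-cong : ∀ n {F G : (Fin n → Carrier) → Carrier} →
                (∀ t → (∀ v → NonZero K isField (t v)) → F t ≈ G t) → ∑units n F ≈ ∑units n G
  ∑units-cong zero    F≈G = F≈G (λ ()) (λ ())
  ∑units-cong (suc n) F≈G = Σ.sum-cong-≋ (λ i → ∑units-cong n (λ t t≉0 →
    F≈G (unit i VecF.∷ t) (λ { zero → unit-nonZero i ; (suc v) → t≉0 v })))

  ∑units-+ : ∀ n F G → ∑units n (λ t → F t + G t) ≈ ∑units n F + ∑units n G
  ∑units-+ zero    F G = refl
  ∑units-+ (suc n) F G = trans (Σ.sum-cong-≋ (λ i → ∑units-+ n (λ t → F (unit i VecF.∷ t)) (λ t → G (unit i VecF.∷ t))))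
    (Σ.∑-distrib-+ (λ i → ∑units n (λ t → F (unit i VecF.∷ t))) (λ i → ∑units n (λ t → G (unit i VecF.∷ t))))

  ∑units-* : ∀ n a F → ∑units n (λ t → a * F t) ≈ a * ∑units n F
  ∑units-* zero    a F = refl
  ∑units-* (suc n) a F = trans (Σ.sum-cong-≋ (λ i → ∑units-* n a (λ t → F (unit i VecF.∷ t))))
    (sym (Σ.*-distribˡ-sum a (λ i → ∑units n (λ t → F (unit i VecF.∷ t)))))

  -- A monomial is a product of functions of the separate coordinates, so the iterated sum factors.
  ∑units-mono : ∀ n b → ∑units n (λ t → mono t b) ≈ product (λ v → powerSum (b v))
  ∑units-mono zero    b = refl
  ∑units-mono (suc n) b = begin
    sum (λ i → ∑units n (λ t → unit i ^ b zero * mono t (b ∘ suc)))              ≈⟨ Σ.sum-cong-≋ (λ i → trans (∑units-* n (unit i ^ b zero) (λ t → mono t (b ∘ suc))) (*-congˡ (∑units-mono n (b ∘ suc)))) ⟩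
    sum (λ i → unit i ^ b zero * product (λ v → powerSum (b (suc v))))           ≈⟨ Σ.*-distribʳ-sum (product (λ v → powerSum (b (suc v)))) (λ i → unit i ^ b zero) ⟨
    powerSum (b zero) * product (λ v → powerSum (b (suc v)))                     ∎

  ∑units-one-nonZero : ∀ n → NonZero K isField (∑units n (λ _ → 1#))
  ∑units-one-nonZero n ∑1≈0 = product-nonZero {n} (λ _ → sum-ones-nonZero) (begin
    product {n} (λ _ → powerSum 0)                 ≈⟨ ∑units-mono n (λ _ → 0) ⟨
    ∑units n (λ t → mono t (λ _ → 0))              ≈⟨ ∑units-cong n (λ _ _ → Π.sum-replicate-zero n) ⟩
    ∑units n (λ _ → 1#)                            ≈⟨ ∑1≈0 ⟩
    0#                                             ∎)

-- Monomials on the toric set.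

module ToricSet {c ℓ : Level} (K : CommutativeRing c ℓ) (isField : IsField K) (r : ℕ)
                (card : HasCardinality (CommutativeRing.setoid K) (suc (suc r)))
                {n s : ℕ} (G : SimpleGraph n s) (orientation : CyclicOrientation G)
                (k′ : ℕ) (n≡2k : n ≡ 2 ℕ.* suc k′) (e₀ : Fin s) where
  open FieldLemmas K isField
  open FiniteField K isField r card
  open Monomials K isField
  open Polynomials K isField s
  open UnitSums K isField r card
  open SimpleGraph G
  open CyclicOrientation orientation
  open SetoidReasoning setoid

  X = toricSet K isField G

  open Interpolation K isField r card X

  Units : ∀ {m} → (Fin m → Carrier) → Set ℓ
  Units t = ∀ i → NonZero K isField (t i)

  toric : (Fin n → Carrier) → Point
  toric t e = t (src e) * t (tgt e)

  toric-nonZero : ∀ {t} → Units t → Units (toric t)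
  toric-nonZero t≉0 e = *-nonZero K isField (t≉0 (src e)) (t≉0 (tgt e))

  toric-edge : ∀ t v → toric t (edge ⟨$⟩ʳ v) ≈ t v * t (next ⟨$⟩ʳ v)
  toric-edge t v with edge-joins v
  ... | inj₁ (src≡ , tgt≡) = *-cong (reflexive (≡.cong t src≡)) (reflexive (≡.cong t tgt≡))
  ... | inj₂ (src≡ , tgt≡) = trans (*-cong (reflexive (≡.cong t src≡)) (reflexive (≡.cong t tgt≡))) (*-comm _ _)

  -- Each edge coordinate splits into its two endpoints; reindexing the second factors by `prev`
  -- collects the exponents of each `t v`.
  mono-toric : ∀ t a → mono (toric t) a ≈ mono t (vertexDegree a)
  mono-toric t a = begin
    mono (toric t) a                                                       ≈⟨ Π.sum-permute (λ e → toric t e ^ a e) edge ⟩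
    mono (λ v → toric t (edge ⟨$⟩ʳ v)) b                                   ≈⟨ mono-cong {a = b} (toric-edge t) (λ _ → ≡.refl) ⟩
    mono (λ v → t v * t (next ⟨$⟩ʳ v)) b                                   ≈⟨ mono-* t (λ v → t (next ⟨$⟩ʳ v)) b ⟩
    mono t b * mono (λ v → t (next ⟨$⟩ʳ v)) b                              ≈⟨ *-congˡ (Π.sum-permute (λ v → t (next ⟨$⟩ʳ v) ^ b v) (Perm.flip next)) ⟩
    mono t b * mono (λ v → t (next ⟨$⟩ʳ prev v)) (b ∘ prev)                ≈⟨ *-congˡ (mono-cong {a = b ∘ prev} (λ v → reflexive (≡.cong t (next-prev v))) (λ _ → ≡.refl)) ⟩
    mono t b * mono t (b ∘ prev)                                           ≈⟨ mono-+ t b (b ∘ prev) ⟨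
    mono t (vertexDegree a)                                                ∎
    where
    b : Fin n → ℕ
    b v = a (edge ⟨$⟩ʳ v)

  toricPoint : ∀ t → Units t → ∃ X
  toricPoint t t≉0 = record { coords = toric t ; nonzero = e₀ , toric-nonZero t≉0 e₀ }
                   , t , t≉0 , ∼-refl K isField

  -- Lower bound for the degree.

  module Least (d : ℕ) (h : ℕ) (H≡h : HilbertFunction K isField X d h)
               (|X|≡h : HasCardinality (pointSetoid K isField X) h) where
    private
      module X = Inverse |X|≡h

      complement = ∃complement N (d ℕ.+ suc k′)
      δ = proj₁ complement
      y = proj₁ (proj₂ (proj₂ complement))

    gap : Fin s → ℕ
    gap = gaps e₀ δ

    sum-gap : Σℕ.sum gap ≡ suc k′ ℕ.+ δ
    sum-gap = sum-gaps (suc k′) n≡2k e₀ δ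

    d+sum-gap : d ℕ.+ Σℕ.sum gap ≡ N ℕ.* y
    d+sum-gap = ≡.trans (≡.cong (d ℕ.+_) sum-gap)
      (≡.trans (≡.sym (ℕ.+-assoc d (suc k′) δ)) (proj₂ (proj₂ (proj₂ complement))))

    private
      -- The prescribed values are inverses of the values of the monomial, because
      -- `m ^ r * m = m ^ N = 1` for a unit `m`.
      dual = interpolation d |X|≡h H≡h (λ i → mono (point d |X|≡h i) gap ^ r)
      F = proj₁ dual
      F-hom = proj₁ (proj₂ dual)

    -- Interpolation controls only the chosen representatives, while the sum runs over all
    -- `toric t`. The two differ by a scalar `z`, which enters with exponent `d + Σℕ.sum gap`; `δ`
    -- was chosen to make this a multiple of `N`, so that the scalar drops out.
    F*mono≈1 : ∀ t → Units t → eval K s F (toric t) * mono (toric t) gap ≈ 1#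
    F*mono≈1 t t≉0 = begin
      f * m                                            ≈⟨ *-identityˡ _ ⟨
      1# * (f * m)                                     ≈⟨ *-congʳ z^≈1 ⟨
      z ^ (d ℕ.+ Σℕ.sum gap) * (f * m)                 ≈⟨ *-congʳ (^-homo-* z d (Σℕ.sum gap)) ⟩
      z ^ d * z ^ Σℕ.sum gap * (f * m)                 ≈⟨ interchange (z ^ d) (z ^ Σℕ.sum gap) f m ⟩
      z ^ d * f * (z ^ Σℕ.sum gap * m)                 ≈⟨ *-cong (eval-homogeneous-scale F F-hom z x) (mono-scale z x gap) ⟨
      eval K s F (λ e → z * x e) * mono (λ e → z * x e) gap   ≈⟨ *-cong (eval-congʳ F P≈zx) (mono-cong {a = gap} P≈zx (λ _ → ≡.refl)) ⟨
      eval K s F P * mono P gap                        ≈⟨ *-congʳ (proj₂ (proj₂ dual) i) ⟩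
      mono P gap ^ r * mono P gap                      ≈⟨ *-comm _ _ ⟩
      mono P gap ^ N                                   ≈⟨ x^N≈1 (mono-nonZero gap P≉0) ⟩
      1#                                               ∎
      where
      open CommutativeSemigroupProperties *-commutativeSemigroup using (interchange)
      x = toric t
      f = eval K s F x
      m = mono x gap
      i = X.to (toricPoint t t≉0)
      P = point d |X|≡h i

      P∼x : _∼_ K isField P x
      P∼x = X.strictlyInverseʳ (toricPoint t t≉0)

      z = proj₁ P∼x
      z≉0 = proj₁ (proj₂ P∼x)
      P≈zx = proj₂ (proj₂ P∼x)

      P≉0 : Units P
      P≉0 e Pe≈0 = *-nonZero K isField z≉0 (toric-nonZero t≉0 e) (trans (sym (P≈zx e)) Pe≈0)

      z^≈1 : z ^ (d ℕ.+ Σℕ.sum gap) ≈ 1#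
      z^≈1 = begin
        z ^ (d ℕ.+ Σℕ.sum gap)     ≈⟨ ^-congʳ z d+sum-gap ⟩
        z ^ (N ℕ.* y)              ≈⟨ ^-assocʳ z N y ⟨
        (z ^ N) ^ y                ≈⟨ ^-congˡ y (x^N≈1 z≉0) ⟩
        1# ^ y                     ≈⟨ 1^n≈1 y ⟩
        1#                         ∎

    degree-bound : ∀ a → Σℕ.sum a ≡ d → (∀ v → N ℕ.∣ vertexDegree (λ e → a e ℕ.+ gap e) v) →
                   r ℕ.* k′ ℕ.≤ d
    degree-bound a a≡d N∣ = k*N≤d+k+δ⇒r*k′≤d r k′ d δ (proj₁ (proj₂ complement))
      (≡.subst (λ x → suc k′ ℕ.* N ℕ.≤ x ℕ.+ (suc k′ ℕ.+ δ)) a≡d (divisible-vertexDegrees (suc k′) n≡2k e₀ δ a N N∣))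

    -- Each term becomes a monomial in `t`, whose sum is a product of power sums. If all its
    -- exponents were divisible by `N`, then `degree-bound` would contradict the assumption on `d`;
    -- so some power sum vanishes.
    termwise-zero : d ℕ.< r ℕ.* k′ → ∀ p → TermsOfDegree d p →
                    ∑units n (λ t → eval K s p (toric t) * mono (toric t) gap) ≈ 0#
    termwise-zero d<rk′ []            []          = trans
      (∑units-* n 0# (λ t → mono (toric t) gap)) (zeroˡ _)
    termwise-zero d<rk′ ((a , e) ∷ p) (e≡d ∷ p≡d) = begin
      ∑units n (λ t → (a * mono (toric t) (Vec.lookup e) + eval K s p (toric t)) * mono (toric t) gap)
        ≈⟨ ∑units-cong n (λ t _ → trans (distribʳ _ _ _) (+-congʳ (trans (*-assoc _ _ _) (*-congˡ (monomial t))))) ⟩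
      ∑units n (λ t → a * mono t b + eval K s p (toric t) * mono (toric t) gap)
        ≈⟨ ∑units-+ n (λ t → a * mono t b) (λ t → eval K s p (toric t) * mono (toric t) gap) ⟩
      ∑units n (λ t → a * mono t b) + ∑units n (λ t → eval K s p (toric t) * mono (toric t) gap)
        ≈⟨ +-cong (∑units-* n a (λ t → mono t b)) (termwise-zero d<rk′ p p≡d) ⟩
      a * ∑units n (λ t → mono t b) + 0#
        ≈⟨ trans (+-identityʳ _) (*-congˡ (trans (∑units-mono n b) product≈0)) ⟩
      a * 0#
        ≈⟨ zeroʳ a ⟩
      0# ∎
      where
      b : Fin n → ℕ
      b = vertexDegree (λ i → Vec.lookup e i ℕ.+ gap i)

      monomial : ∀ t → mono (toric t) (Vec.lookup e) * mono (toric t) gap ≈ mono t b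
      monomial t = trans (sym (mono-+ (toric t) (Vec.lookup e) gap))
                         (mono-toric t (λ i → Vec.lookup e i ℕ.+ gap i))

      product≈0 : product (λ v → powerSum (b v)) ≈ 0#
      product≈0 with Fin.any? (λ v → ¬? (N ℕ.∣? b v))
      ... | yes (v , N∤bv) = product-zero _ v (powerSum-zero (b v) N∤bv)
      ... | no none = contradiction (degree-bound (Vec.lookup e) (≡.trans (sum-lookup e) e≡d)
                        (λ v → decidable-stable (N ℕ.∣? b v) (λ N∤ → none (v , N∤)))) (ℕ.<⇒≱ d<rk′)

    -- Below the bound the sum over all unit vectors would be zero, whereas the constant value 1
    -- gives a nonzero sum.
    dual⇒degree-bound : ∀ f → Homogeneous K s d f →
      (∀ t → Units t → eval K s f (toric t) * mono (toric t) gap ≈ 1#) → r ℕ.* k′ ℕ.≤ d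
    dual⇒degree-bound f f-hom f*mono≈1 with homogeneous⇒termsOfDegree f f-hom
    ... | p , p≡d , f≈p = ℕ.≮⇒≥ λ d<rk′ → ∑units-one-nonZero n (begin
      ∑units n (λ _ → 1#)                                                  ≈⟨ ∑units-cong n f*mono≈1 ⟨
      ∑units n (λ t → eval K s f (toric t) * mono (toric t) gap)           ≈⟨ ∑units-cong n (λ t _ → *-congʳ (eval-cong f p f≈p (toric t))) ⟩
      ∑units n (λ t → eval K s p (toric t) * mono (toric t) gap)           ≈⟨ termwise-zero d<rk′ p p≡d ⟩
      0#                                                                   ∎)

    least : r ℕ.* k′ ℕ.≤ d
    least = dual⇒degree-bound F F-hom F*mono≈1

  -- Reduction to degree `d₀` and indicator forms.

  mono-% : ∀ {x : Point} → Units x → ∀ a b → (∀ e → a e ℕ.% N ≡ b e ℕ.% N) → mono x a ≈ mono x b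
  mono-% {x} x≉0 a b a≡b = Π.sum-cong-≋ λ e → begin
    x e ^ a e             ≈⟨ ^-% (x≉0 e) (a e) ⟨
    x e ^ (a e ℕ.% N)     ≈⟨ ^-congʳ (x e) (a≡b e) ⟩
    x e ^ (b e ℕ.% N)     ≈⟨ ^-% (x≉0 e) (b e) ⟩
    x e ^ b e             ∎

  -- Every vertex meets one edge of each colour and so receives total exponent `N`; each factor
  -- `t v ^ N` is 1.
  mono-shift : ∀ {t} → Units t → ∀ j → mono (toric t) (λ e → shift {N} (edgeColour e) j) ≈ 1#
  mono-shift {t} t≉0 j = begin
    mono (toric t) (λ e → shift (edgeColour e) j)               ≈⟨ mono-toric t (λ e → shift (edgeColour e) j) ⟩
    mono t (vertexDegree (λ e → shift (edgeColour e) j))        ≈⟨ mono-cong {x = t} (λ _ → refl) (λ v → ≡.trans (vertexDegree-edgeColour (λ c → shift c j) v) (suc[toℕ]+opposite j)) ⟩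
    mono t (λ _ → N)                                            ≈⟨ Π.sum-cong-≋ (λ v → x^N≈1 (t≉0 v)) ⟩
    product {n} (λ _ → 1#)                                      ≈⟨ Π.sum-replicate-zero n ⟩
    1#                                                          ∎

  d₀ : ℕ
  d₀ = r ℕ.* k′

  record Reduced (a : Fin s → ℕ) : Set (c ⊔ ℓ) where
    field
      exponent    : Fin s → ℕ
      degree      : Σℕ.sum exponent ≡ d₀
      mono-toric≈ : ∀ {t} → Units t → mono (toric t) exponent ≈ mono (toric t) a

  reduce : ∀ a → Σℕ.sum a ℕ.% N ≡ d₀ ℕ.% N → Reduced a
  reduce a a≡d₀ = record { exponent = b′ ; degree = b′≡d₀ ; mono-toric≈ = λ {t} t≉0 → begin
    mono (toric t) b′                                                          ≈⟨ mono-% (toric-nonZero t≉0) b′ (λ e → a e ℕ.+ shift (edgeColour e) j) b′≡a+shift ⟩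
    mono (toric t) (λ e → a e ℕ.+ shift (edgeColour e) j)                      ≈⟨ mono-+ (toric t) a (λ e → shift (edgeColour e) j) ⟩
    mono (toric t) a * mono (toric t) (λ e → shift (edgeColour e) j)           ≈⟨ *-congˡ (mono-shift t≉0 j) ⟩
    mono (toric t) a * 1#                                                      ≈⟨ *-identityʳ _ ⟩
    mono (toric t) a                                                           ∎ }
    where
    light : ∃ λ (j : Fin N) → Σℕ.sum (λ e → (a e ℕ.+ shift (edgeColour e) j) ℕ.% N) ℕ.≤ suc k′ ℕ.* r
    light = ∃light-shift r (suc k′) edgeColour a (≡.trans (≡.sym (Perm.↔⇒≡ edge)) n≡2k)

    j = proj₁ light

    b : Fin s → ℕ
    b e = (a e ℕ.+ shift (edgeColour e) j) ℕ.% N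

    b≡d₀ : Σℕ.sum b ℕ.% N ≡ d₀ ℕ.% N
    b≡d₀ = ≡.trans (sum-% N (λ e → a e ℕ.+ shift (edgeColour e) j))
      (≡.trans (≡.cong (ℕ._% N) (≡.trans (Σℕ.∑-distrib-+ a (λ e → shift (edgeColour e) j))
        (≡.cong (Σℕ.sum a ℕ.+_) (≡.trans (sum-edgeColour (suc k′) n≡2k (λ c → shift c j))
          (≡.cong (suc k′ ℕ.*_) (suc[toℕ]+opposite j))))))
      (≡.trans (ℕ.[m+kn]%n≡m%n (Σℕ.sum a) (suc k′) N) a≡d₀))

    -- The average bound `suc k′ * r` equals `r + d₀`, just below `N + d₀`.
    b<N+d₀ : Σℕ.sum b ℕ.< N ℕ.+ d₀
    b<N+d₀ = ℕ.s≤s (ℕ.≤-trans (proj₂ light) (ℕ.≤-reflexive (≡.cong (r ℕ.+_) (ℕ.*-comm k′ r))))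

    padding : ∃ λ y → Σℕ.sum b ℕ.+ y ℕ.* N ≡ d₀
    padding = %≡∧<⇒∃multiple N (Σℕ.sum b) d₀ b≡d₀ b<N+d₀

    y = proj₁ padding

    -- All the missing degree is put on the variable `e₀`; being a multiple of `N`, it does not
    -- change values at units.
    b′ : Fin s → ℕ
    b′ e = b e ℕ.+ y ℕ.* N ℕ.* indicator e₀ e

    b′≡d₀ : Σℕ.sum b′ ≡ d₀
    b′≡d₀ = ≡.trans (Σℕ.∑-distrib-+ b (λ e → y ℕ.* N ℕ.* indicator e₀ e))
      (≡.trans (≡.cong (Σℕ.sum b ℕ.+_) (≡.trans (≡.sym (Σℕ.*-distribˡ-sum (y ℕ.* N) (indicator e₀)))
        (≡.trans (≡.cong (y ℕ.* N ℕ.*_) (Σℕ-indicator e₀)) (ℕ.*-identityʳ _)))) (proj₂ padding))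

    b′≡a+shift : ∀ e → b′ e ℕ.% N ≡ (a e ℕ.+ shift (edgeColour e) j) ℕ.% N
    b′≡a+shift e = ≡.trans (≡.cong (λ x → (b e ℕ.+ x) ℕ.% N) (*-swapʳ y N (indicator e₀ e)))
      (≡.trans (ℕ.[m+kn]%n≡m%n (b e) (y ℕ.* indicator e₀ e) N) (ℕ.m%n%n≡m%n (a e ℕ.+ shift (edgeColour e) j) N))
      where open CommutativeSemigroupProperties ℕ.*-commutativeSemigroup using () renaming (xy∙z≈xz∙y to *-swapʳ)

  reducePoly : ∀ {D} → D ℕ.% N ≡ d₀ ℕ.% N → ∀ p → TermsOfDegree D p →
    ∃ λ p′ → TermsOfDegree d₀ p′ × (∀ {t} → Units t → eval K s p′ (toric t) ≈ eval K s p (toric t))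
  reducePoly D≡d₀ []            []          = [] , [] , λ _ → refl
  reducePoly D≡d₀ ((a , e) ∷ p) (e≡D ∷ p≡D) =
    (a , Vec.tabulate exponent) ∷ proj₁ rest
    , ≡.trans (≡.sym (sum-lookup (Vec.tabulate exponent))) (≡.trans (Σℕ.sum-cong-≗ (Vec.lookup∘tabulate exponent)) degree) ∷ proj₁ (proj₂ rest)
    , λ {t} t≉0 → +-cong (*-congˡ (trans (mono-cong {x = toric t} (λ _ → refl) (Vec.lookup∘tabulate exponent)) (mono-toric≈ t≉0)))
                         (proj₂ (proj₂ rest) t≉0)
    where
    rest = reducePoly D≡d₀ p p≡D
    open Reduced (reduce (Vec.lookup e) (≡.trans (≡.cong (ℕ._% N) (≡.trans (sum-lookup e) e≡D)) D≡d₀))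

  -- For units the factor of e is 1 when y e / y e₀ ≈ x e / x e₀, and 0 otherwise.
  factor : (ρ : Carrier) → Fin s → Point → Carrier
  factor ρ e y = y e₀ ^ N + - 1# * (y e + - ρ * y e₀) ^ N

  factor-form : ∀ ρ e → IsForm (N ℕ.* 1) (factor ρ e)
  factor-form ρ e = +-form (^-form N (coordinate-form e₀))
    (·-form (- 1#) (^-form N (+-form (coordinate-form e) (·-form (- ρ) (coordinate-form e₀)))))

  factor-one : ∀ {ρ e} {y : Point} → Units y → y e ≈ ρ * y e₀ → factor ρ e y ≈ 1#
  factor-one {ρ} {e} {y} y≉0 ye≈ = begin
    y e₀ ^ N + - 1# * (y e + - ρ * y e₀) ^ N       ≈⟨ +-cong (x^N≈1 (y≉0 e₀)) (*-congˡ (^-congˡ N (trans (+-congˡ (sym (-‿distribˡ-* ρ (y e₀)))) (x≈y⇒x-y≈0 ye≈)))) ⟩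
    1# + - 1# * 0# ^ N                             ≈⟨ +-congˡ (*-congˡ (zeroˡ _)) ⟩
    1# + - 1# * 0#                                 ≈⟨ +-congˡ (zeroʳ _) ⟩
    1# + 0#                                        ≈⟨ +-identityʳ 1# ⟩
    1#                                             ∎

  factor-zero : ∀ {ρ e} {y : Point} → Units y → ¬ (y e ≈ ρ * y e₀) → factor ρ e y ≈ 0#
  factor-zero {ρ} {e} {y} y≉0 ye≉ = begin
    y e₀ ^ N + - 1# * (y e + - ρ * y e₀) ^ N       ≈⟨ +-cong (x^N≈1 (y≉0 e₀)) (*-congˡ (x^N≈1 λ ≈0 → ye≉ (x-y≈0⇒x≈y _ _ (trans (+-congˡ (-‿distribˡ-* ρ (y e₀))) ≈0)))) ⟩
    1# + - 1# * 1#                                 ≈⟨ +-congˡ (*-identityʳ _) ⟩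
    1# - 1#                                        ≈⟨ -‿inverseʳ 1# ⟩
    0#                                             ∎

  -- The factors have degree `N`, so the power of `y e₀`, nonzero at units, puts the total degree in
  -- the residue class of `d₀`.
  separator : (ρ : Fin s → Carrier) → Point → Carrier
  separator ρ y = y e₀ ^ d₀ * product (λ e → factor (ρ e) e y)

  separator-form : ∀ ρ → IsForm (d₀ ℕ.* 1 ℕ.+ s ℕ.* (N ℕ.* 1)) (separator ρ)
  separator-form ρ = *-form (^-form d₀ (coordinate-form e₀)) (product-form (λ e → factor-form (ρ e) e))

  separator-degree : (d₀ ℕ.* 1 ℕ.+ s ℕ.* (N ℕ.* 1)) ℕ.% N ≡ d₀ ℕ.% N
  separator-degree = ≡.trans (≡.cong (ℕ._% N) (≡.cong₂ (λ x y → x ℕ.+ s ℕ.* y) (ℕ.*-identityʳ d₀) (ℕ.*-identityʳ N)))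
                             (ℕ.[m+kn]%n≡m%n d₀ s N)

  separator-nonZero : ∀ {ρ} {y : Point} → Units y → (∀ e → y e ≈ ρ e * y e₀) → NonZero K isField (separator ρ y)
  separator-nonZero {ρ} y≉0 y≈ρ = *-nonZero K isField (^-nonZero d₀ (y≉0 e₀))
    (product-nonZero (λ e factor≈0 → 1≉0 (trans (sym (factor-one {ρ e} {e} y≉0 (y≈ρ e))) factor≈0)))

  separator-zero : ∀ {ρ} {y : Point} → Units y → ∀ e → ¬ (y e ≈ ρ e * y e₀) → separator ρ y ≈ 0#
  separator-zero {ρ} y≉0 e y≉ρ = trans (*-congˡ (product-zero _ e (factor-zero {ρ e} {e} y≉0 y≉ρ))) (zeroʳ _)

  reduceForm : ∀ {D F} → D ℕ.% N ≡ d₀ ℕ.% N → IsForm D F →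
    ∃ λ f → Homogeneous K s d₀ f × (∀ {t} → Units t → eval K s f (toric t) ≈ F (toric t))
  reduceForm D≡d₀ (p , p≡D , p≈F) with reducePoly D≡d₀ p p≡D
  ... | f , f≡d₀ , f≈p = f , termsOfDegree⇒homogeneous f≡d₀ , λ {t} t≉0 → trans (f≈p t≉0) (p≈F (toric t))

  IsIndicator : Point → Poly K s → Set (c ⊔ ℓ)
  IsIndicator x f = Homogeneous K s d₀ f ×
    (∀ t → Units t → (∀ e → toric t e ≈ x e) → NonZero K isField (eval K s f (toric t))) ×
    (∀ t → Units t → ¬ _∼_ K isField (toric t) x → eval K s f (toric t) ≈ 0#)

  -- As the coordinate at `e₀` is nonzero, the ratios of all coordinates to it determine the
  -- projective point, and the separator tests exactly these ratios.
  separator⇒indicator : ∀ {x : Point} {x₀⁻¹} → x₀⁻¹ * x e₀ ≈ 1# → ∀ f → Homogeneous K s d₀ f →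
    (∀ {t} → Units t → eval K s f (toric t) ≈ separator (λ e → x e * x₀⁻¹) (toric t)) → IsIndicator x f
  separator⇒indicator {x} {x₀⁻¹} x₀⁻¹x₀≈1 f f-hom f≈ = f-hom , nonZero , vanishing
    where
    ρ : Fin s → Carrier
    ρ e = x e * x₀⁻¹

    ρ*x₀ : ∀ e → ρ e * x e₀ ≈ x e
    ρ*x₀ e = trans (*-assoc _ _ _) (trans (*-congˡ x₀⁻¹x₀≈1) (*-identityʳ _))

    nonZero : ∀ t → Units t → (∀ e → toric t e ≈ x e) → NonZero K isField (eval K s f (toric t))
    nonZero t t≉0 t≈x ≈0 = separator-nonZero {ρ} (toric-nonZero t≉0)
      (λ e → trans (t≈x e) (trans (sym (ρ*x₀ e)) (*-congˡ (sym (t≈x e₀))))) (trans (sym (f≈ t≉0)) ≈0)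

    vanishing : ∀ t → Units t → ¬ _∼_ K isField (toric t) x → eval K s f (toric t) ≈ 0#
    vanishing t t≉0 t≁x with Fin.any? (λ e → ¬? (toric t e ≟ ρ e * toric t e₀))
    ... | yes (e , ≉) = trans (f≈ t≉0) (separator-zero {ρ} (toric-nonZero t≉0) e ≉)
    ... | no none = contradiction
      -- If all ratios agree, the points are proportional with the quotient of their `e₀`
      -- coordinates as scalar.
      ( toric t e₀ * x₀⁻¹
      , *-nonZero K isField (toric-nonZero t≉0 e₀) (inverse-nonZero K isField x₀⁻¹x₀≈1)
      , λ e → begin
        toric t e                       ≈⟨ decidable-stable (toric t e ≟ ρ e * toric t e₀) (λ ≉ → none (e , ≉)) ⟩
        x e * x₀⁻¹ * toric t e₀         ≈⟨ *-comm _ _ ⟩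
        toric t e₀ * (x e * x₀⁻¹)       ≈⟨ *-congˡ (*-comm _ _) ⟩
        toric t e₀ * (x₀⁻¹ * x e)       ≈⟨ *-assoc _ _ _ ⟨
        toric t e₀ * x₀⁻¹ * x e         ∎) t≁x

  toricIndicator : ∀ x → Units x → ∃ (IsIndicator x)
  toricIndicator x x≉0 with invertible (x e₀) (x≉0 e₀)
  ... | x₀⁻¹ , x₀⁻¹x₀≈1 , _ = proj₁ f , separator⇒indicator x₀⁻¹x₀≈1 (proj₁ f) (proj₁ (proj₂ f)) (proj₂ (proj₂ f))
    where
    f = reduceForm separator-degree (separator-form (λ e → x e * x₀⁻¹))

  infix 4 _∼?_
  -- There are only `N` candidates for the scalar, and each can be tested coordinatewise.
  _∼?_ : Decidable (_∼_ K isField {s})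
  x ∼? y with Fin.any? (λ i → Fin.all? (λ e → x e ≟ unit i * y e))
  ... | yes (i , x≈uy) = yes (unit i , unit-nonZero i , x≈uy)
  ... | no none = no λ (z , z≉0 , x≈zy) → none (proj₁ (unitIndex z≉0) ,
    λ e → trans (x≈zy e) (*-congʳ (sym (proj₂ (unitIndex z≉0)))))

  -- Finiteness of the toric set and its regularity index.

  unitVector : Fin (N ℕ.^ n) → Fin n → Carrier
  unitVector i v = unit (finToFun i v)

  toric-cong : ∀ {t t′} → (∀ v → t v ≈ t′ v) → ∀ e → toric t e ≈ toric t′ e
  toric-cong t≈t′ e = *-cong (t≈t′ (src e)) (t≈t′ (tgt e))

  unitVector-covers : ∀ {t} → Units t → ∃ λ i → ∀ v → t v ≈ unitVector i v
  unitVector-covers {t} t≉0 = funToFin index , λ v →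
    trans (sym (proj₂ (unitIndex (t≉0 v)))) (reflexive (≡.cong unit (≡.sym (Fin.finToFun-funToFin index v))))
    where
    index : Fin n → Fin N
    index v = proj₁ (unitIndex (t≉0 v))

  toricSet-finite : ∃ (HasCardinality (pointSetoid K isField X))
  toricSet-finite = finitelyCovered⇒hasCardinality (pointSetoid K isField X)
    (λ P Q → ProjectivePoint.coords (proj₁ P) ∼? ProjectivePoint.coords (proj₁ Q))
    (λ i → toricPoint (unitVector i) (λ v → unit-nonZero (finToFun i v)))
    λ (P , t , t≉0 , z , z≉0 , P≈zx) → proj₁ (unitVector-covers t≉0) , z , z≉0 ,
      λ e → trans (P≈zx e) (*-congˡ (toric-cong (proj₂ (unitVector-covers t≉0)) e))

  eval-∼ : ∀ f → Homogeneous K s d₀ f → ∀ {x y} ((z , _) : _∼_ K isField x y) →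
           eval K s f x ≈ z ^ d₀ * eval K s f y
  eval-∼ f f-hom {y = y} (z , _ , x≈zy) = trans (eval-congʳ f x≈zy) (eval-homogeneous-scale f f-hom z y)

  hilbertFunction : ∀ {h} → HasCardinality (pointSetoid K isField X) h → HilbertFunction K isField X d₀ h
  hilbertFunction {h} |X|≡h = indicators⇒basis d₀ |X|≡h (λ i → indicatorAt i (toricIndicator (x i) (toric-nonZero (t≉0 i))))
    where
    module X = Inverse |X|≡h

    P : Fin h → Point
    P = point d₀ |X|≡h

    t : Fin h → Fin n → Carrier
    t i = proj₁ (proj₂ (X.from i))

    t≉0 : ∀ i → Units (t i)
    t≉0 i = proj₁ (proj₂ (proj₂ (X.from i)))

    x : Fin h → Point
    x i = toric (t i)

    P∼x : ∀ i → _∼_ K isField (P i) (x i)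
    P∼x i = proj₂ (proj₂ (proj₂ (X.from i)))

    x∼x⇒≡ : ∀ {i j} → _∼_ K isField (x i) (x j) → i ≡ j
    x∼x⇒≡ {i} {j} xᵢ∼xⱼ = ≡.trans (≡.sym (X.strictlyInverseˡ i)) (≡.trans
      (X.to-cong {X.from i} {X.from j} (∼-trans K isField (P∼x i) (∼-trans K isField xᵢ∼xⱼ (∼-sym K isField (P∼x j)))))
      (X.strictlyInverseˡ j))

    indicatorAt : ∀ i → ∃ (IsIndicator (x i)) →
      ∃ λ f → Homogeneous K s d₀ f × NonZero K isField (eval K s f (P i)) ×
              (∀ j → j ≢ i → eval K s f (P j) ≈ 0#)
    indicatorAt i (f , f-hom , f-nonZero , f-zero) = f , f-hom
      , (λ fPᵢ≈0 → *-nonZero K isField (^-nonZero d₀ (proj₁ (proj₂ (P∼x i)))) (f-nonZero (t i) (t≉0 i) (λ _ → refl))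
          (trans (sym (eval-∼ f f-hom (P∼x i))) fPᵢ≈0))
      , λ j j≢i → trans (eval-∼ f f-hom (P∼x j))
          (trans (*-congˡ (f-zero (t j) (t≉0 j) (λ xⱼ∼xᵢ → j≢i (x∼x⇒≡ xⱼ∼xᵢ)))) (zeroʳ _))

  isRegularityIndex : IsRegularityIndex K isField X d₀
  isRegularityIndex = record
    { attained = proj₁ toricSet-finite , hilbertFunction (proj₂ toricSet-finite) , proj₂ toricSet-finite
    ; least    = λ d (h , H≡h , |X|≡h) → Least.least d h H≡h |X|≡h
    }

-- Graphs whose components are even cycles

even : ℕ → Bool
even zero    = true
even (suc n) = not (even n)

even-2* : ∀ l → even (2 ℕ.* l) ≡ true
even-2* zero    = ≡.refl
even-2* (suc l) rewrite ℕ.+-suc l (l ℕ.+ 0) = ≡.trans (Bool.not-involutive _) (even-2* l)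

∃CycleNext : ∀ {N} (a : Fin N) → ∃ (CycleNext N a)
∃CycleNext {N} a with suc (toℕ a) ℕ.<? N
... | yes 1+a<N = fromℕ< 1+a<N , inj₁ (≡.sym (Fin.toℕ-fromℕ< 1+a<N))
... | no 1+a≮N  = fromℕ< 0<N , inj₂ (ℕ.≤-antisym (Fin.toℕ<n a) (ℕ.≮⇒≥ 1+a≮N) , Fin.toℕ-fromℕ< 0<N)
  where
  0<N : 0 ℕ.< N
  0<N = ℕ.≤-<-trans ℕ.z≤n (Fin.toℕ<n a)

module CycleComponents {n s : ℕ} (G : SimpleGraph n s) (m : ℕ) (l : Fin m → ℕ) (2≤l : ∀ i → 2 ℕ.≤ l i)
                       (cycles : ComponentsAreCycles G m (λ i → 2 ℕ.* l i)) where
  open SimpleGraph G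
  open ComponentsAreCycles cycles

  private
    C : Fin n → Fin m
    C = component

    module φ (i : Fin m) = Inverse (proj₁ (component-cycle i))
    module φ-adjacent (i : Fin m) u v = Equivalence (proj₂ (component-cycle i) u v)

  size : Fin n → ℕ
  size v = 2 ℕ.* l (C v)

  position : Fin n → ℕ
  position v = toℕ (φ.to (C v) (v , ≡.refl))

  -- Lets the position of `v` be read off in a component `i` that equals `C v` only propositionally,
  -- as is needed to compare two vertices of one component.
  position≡ : ∀ {i} v (Cv≡i : C v ≡ i) → toℕ (φ.to i (v , Cv≡i)) ≡ position v
  position≡ v ≡.refl = ≡.refl

  position<size : ∀ v → position v ℕ.< size v
  position<size v = Fin.toℕ<n (φ.to (C v) (v , ≡.refl))

  position-injective : ∀ {v w} → C v ≡ C w → position v ≡ position w → v ≡ w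
  position-injective {v} {w} Cv≡Cw eq = ≡.cong proj₁ (≡.trans (≡.sym (φ.strictlyInverseʳ (C w) (v , Cv≡Cw)))
    (≡.trans (≡.cong (φ.from (C w)) (Fin.toℕ-injective (≡.trans (position≡ v Cv≡Cw) eq)))
      (φ.strictlyInverseʳ (C w) (w , ≡.refl))))

  -- Cyclic succession stated through numerical positions, so that vertices can be compared without
  -- transport between the types of different components.
  record Step (v w : Fin n) : Set where
    constructor step
    field
      sameComponent : C v ≡ C w
      consecutive   : (suc (position v) ≡ position w) ⊎ (suc (position v) ≡ size v × position w ≡ 0)

  Step-functional : ∀ {v w w′} → Step v w → Step v w′ → w ≡ w′
  Step-functional {v} {w} {w′} (step c p) (step c′ p′) = position-injective (≡.trans (≡.sym c) c′) (same p p′)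
    where
    too-large : ∀ {u} → C v ≡ C u → suc (position v) ≡ position u → suc (position v) ≢ size v
    too-large {u} c eq eq′ = ℕ.<⇒≢ (position<size u) (≡.trans (≡.sym eq) (≡.trans eq′ (≡.cong (λ i → 2 ℕ.* l i) c)))

    same : (suc (position v) ≡ position w) ⊎ (suc (position v) ≡ size v × position w ≡ 0) →
           (suc (position v) ≡ position w′) ⊎ (suc (position v) ≡ size v × position w′ ≡ 0) →
           position w ≡ position w′
    same (inj₁ eq)       (inj₁ eq′)       = ≡.trans (≡.sym eq) eq′
    same (inj₁ eq)       (inj₂ (eq′ , _)) = contradiction eq′ (too-large c eq)
    same (inj₂ (eq , _)) (inj₁ eq′)       = contradiction eq (too-large c′ eq′)
    same (inj₂ (_ , eq)) (inj₂ (_ , eq′)) = ≡.trans eq (≡.sym eq′)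

  Step-injective : ∀ {v v′ w} → Step v w → Step v′ w → v ≡ v′
  Step-injective {v} {v′} {w} (step c p) (step c′ p′) = position-injective Cv≡Cv′ (ℕ.suc-injective (same p p′))
    where
    Cv≡Cv′ : C v ≡ C v′
    Cv≡Cv′ = ≡.trans c (≡.sym c′)

    same : (suc (position v) ≡ position w) ⊎ (suc (position v) ≡ size v × position w ≡ 0) →
           (suc (position v′) ≡ position w) ⊎ (suc (position v′) ≡ size v′ × position w ≡ 0) →
           suc (position v) ≡ suc (position v′)
    same (inj₁ eq)       (inj₁ eq′)       = ≡.trans eq (≡.sym eq′)
    same (inj₁ eq)       (inj₂ (_ , w≡0)) = contradiction (≡.trans eq w≡0) λ ()
    same (inj₂ (_ , w≡0)) (inj₁ eq′)      = contradiction (≡.trans eq′ w≡0) λ ()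
    same (inj₂ (eq , _)) (inj₂ (eq′ , _)) = ≡.trans eq (≡.trans (≡.cong (λ i → 2 ℕ.* l i) Cv≡Cv′) (≡.sym eq′))

  2<size : ∀ v → 2 ℕ.< size v
  2<size v = ℕ.≤-trans (ℕ.n≤1+n 3) (ℕ.*-monoʳ-≤ 2 (2≤l (C v)))

  -- Two steps advance by 2 around the cycle, and returning to the start is impossible because the
  -- length exceeds 2. The four cases record which of the steps wraps around.
  Step-asymmetric : ∀ {v w} → Step v w → ¬ Step w v
  Step-asymmetric {v} {w} (step c (inj₁ eq)) (step _ (inj₁ eq′)) =
    ℕ.m≢1+n+m (position v) {1} (≡.sym (≡.trans (≡.cong suc eq) eq′))
  Step-asymmetric {v} {w} (step c (inj₁ eq)) (step _ (inj₂ (eq′ , v≡0))) =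
    ℕ.<⇒≢ (2<size w) (≡.trans (≡.cong (2 ℕ.+_) (≡.sym v≡0)) (≡.trans (≡.cong suc eq) eq′))
  Step-asymmetric {v} {w} (step c (inj₂ (eq , w≡0))) (step _ (inj₁ eq′)) =
    ℕ.<⇒≢ (2<size v) (≡.trans (≡.cong (2 ℕ.+_) (≡.sym w≡0)) (≡.trans (≡.cong suc eq′) eq))
  Step-asymmetric {v} {w} (step c (inj₂ (eq , w≡0))) (step _ (inj₂ (_ , v≡0))) =
    ℕ.<⇒≢ (ℕ.<⇒≤ (2<size v)) (≡.trans (≡.cong suc (≡.sym v≡0)) eq)

  CycleNext⇒Step : ∀ {i} v w (Cv≡i : C v ≡ i) (Cw≡i : C w ≡ i) →
                   CycleNext (2 ℕ.* l i) (φ.to i (v , Cv≡i)) (φ.to i (w , Cw≡i)) → Step v w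
  CycleNext⇒Step v w ≡.refl Cw≡Cv next = step (≡.sym Cw≡Cv)
    (Sum.map (λ eq → ≡.trans eq (position≡ w Cw≡Cv)) (λ (eq , w≡0) → eq , ≡.trans (≡.sym (position≡ w Cw≡Cv)) w≡0) next)

  Adjacent⇒Step : ∀ {v w} → Adjacent v w → Step v w ⊎ Step w v
  Adjacent⇒Step {v} {w} vw = Sum.map (CycleNext⇒Step v w Cv≡Cw ≡.refl) (CycleNext⇒Step w v ≡.refl Cv≡Cw)
    (φ-adjacent.to (C w) (v , Cv≡Cw) (w , ≡.refl) vw)
    where
    Cv≡Cw : C v ≡ C w
    Cv≡Cw = Equivalence.from (component-connected v w) (vw Star.◅ Star.ε)

  ∃Step : ∀ v → ∃ λ w → Step v w × Adjacent v w
  ∃Step v with ∃CycleNext (φ.to (C v) (v , ≡.refl))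
  -- The cyclic successor is pulled back to a vertex `w`; `eq` then identifies the image of `w` with
  -- `b`.
  ... | b , v→b with φ.from (C v) b in eq
  ... | w , Cw≡Cv = w , CycleNext⇒Step v w ≡.refl Cw≡Cv v→w
                      , φ-adjacent.from (C v) (v , ≡.refl) (w , Cw≡Cv) (inj₁ v→w)
    where
    v→w : CycleNext (2 ℕ.* l (C v)) (φ.to (C v) (v , ≡.refl)) (φ.to (C v) (w , Cw≡Cv))
    v→w = ≡.subst (CycleNext _ _) (≡.trans (≡.sym (φ.strictlyInverseˡ (C v) b)) (≡.cong (φ.to (C v)) eq)) v→b

  next : Fin n → Fin n
  next v = proj₁ (∃Step v)

  Step-next : ∀ v → Step v (next v)
  Step-next v = proj₁ (proj₂ (∃Step v))

  next-injective : ∀ {v w} → next v ≡ next w → v ≡ w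
  next-injective {v} {w} eq = Step-injective (Step-next v) (≡.subst (Step w) (≡.sym eq) (Step-next w))

  edge : Fin n → Fin s
  edge v = proj₁ (proj₂ (proj₂ (∃Step v)))

  edge-joins : ∀ v → Joins (edge v) v (next v)
  edge-joins v = proj₂ (proj₂ (proj₂ (∃Step v)))

  -- If one edge served two vertices in opposite directions, each would be the successor of the
  -- other, contrary to asymmetry.
  edge-injective : ∀ {v w} → edge v ≡ edge w → v ≡ w
  edge-injective {v} {w} eq = ends (edge-joins v) (≡.subst (λ e → Joins e w (next w)) (≡.sym eq) (edge-joins w))
    where
    swapped : v ≡ next w → next v ≡ w → v ≡ w
    swapped v≡w⁺ v⁺≡w = contradiction (≡.subst (Step w) (≡.sym v≡w⁺) (Step-next w))
                                      (Step-asymmetric (≡.subst (Step v) v⁺≡w (Step-next v)))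

    ends : ∀ {e} → Joins e v (next v) → Joins e w (next w) → v ≡ w
    ends (inj₁ (src≡v , tgt≡v⁺)) (inj₁ (src≡w , tgt≡w⁺)) = ≡.trans (≡.sym src≡v) src≡w
    ends (inj₁ (src≡v , tgt≡v⁺)) (inj₂ (src≡w⁺ , tgt≡w)) = swapped (≡.trans (≡.sym src≡v) src≡w⁺) (≡.trans (≡.sym tgt≡v⁺) tgt≡w)
    ends (inj₂ (src≡v⁺ , tgt≡v)) (inj₁ (src≡w , tgt≡w⁺)) = swapped (≡.trans (≡.sym tgt≡v) tgt≡w⁺) (≡.trans (≡.sym src≡v⁺) src≡w)
    ends (inj₂ (src≡v⁺ , tgt≡v)) (inj₂ (src≡w⁺ , tgt≡w)) = ≡.trans (≡.sym tgt≡v) tgt≡w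

  -- The endpoints of `e` form a step in one of the two directions. The edge chosen at the start of
  -- this step joins the same endpoints, so it is `e` for lack of parallel edges.
  edge-surjective : ∀ e → ∃ λ v → edge v ≡ e
  edge-surjective e with Adjacent⇒Step (e , inj₁ (≡.refl , ≡.refl))
  ... | inj₁ src→tgt = src e , ≡.sym (noParallelEdges e (edge (src e))
          (ends (≡.subst (Joins _ _) (Step-functional (Step-next (src e)) src→tgt) (edge-joins (src e)))))
    where
    ends : ∀ {f} → Joins f (src e) (tgt e) → Joins e (src f) (tgt f)
    ends (inj₁ (p , q)) = inj₁ (≡.sym p , ≡.sym q)
    ends (inj₂ (p , q)) = inj₂ (≡.sym q , ≡.sym p)
  ... | inj₂ tgt→src = tgt e , ≡.sym (noParallelEdges e (edge (tgt e))
          (ends (≡.subst (Joins _ _) (Step-functional (Step-next (tgt e)) tgt→src) (edge-joins (tgt e)))))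
    where
    ends : ∀ {f} → Joins f (tgt e) (src e) → Joins e (src f) (tgt f)
    ends (inj₁ (p , q)) = inj₂ (≡.sym q , ≡.sym p)
    ends (inj₂ (p , q)) = inj₁ (≡.sym p , ≡.sym q)

  -- The parity changes at the wrap-around too: the length is even, so the last position is odd and
  -- the first is 0.
  even-Step : ∀ {v w} → Step v w → even (position w) ≡ not (even (position v))
  even-Step (step _ (inj₁ eq))            = ≡.cong even (≡.sym eq)
  even-Step {v} (step _ (inj₂ (eq , w≡0))) =
    ≡.trans (≡.cong even w≡0) (≡.trans (≡.sym (even-2* (l (C v)))) (≡.cong even (≡.sym eq)))

  cyclicOrientation : CyclicOrientation G
  cyclicOrientation = record
    { next        = injective⇒permutation next next-injective
    ; edge        = permutation edge (proj₁ ∘ edge-surjective) (proj₂ ∘ edge-surjective)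
                      (λ v → edge-injective (proj₂ (edge-surjective (edge v))))
    ; edge-joins  = edge-joins
    ; colour      = even ∘ position
    ; colour-next = λ v → even-Step (Step-next v)
    }

-- Regularity index of a disjoint union of even cycles.

open import Data.Nat.Base using (_*_; _∸_; _≤_)

corollary5p5 : {c ℓ : Level} (K : CommutativeRing c ℓ) (isField : IsField K)
    (q : ℕ) → HasCardinality (CommutativeRing.setoid K) q →
    (k s : ℕ) (G : SimpleGraph (2 * k) s)
    (m : ℕ) (l : Fin m → ℕ) → 1 ≤ m → (∀ i → 2 ≤ l i) →
    ComponentsAreCycles G m (λ i → 2 * l i) →
    IsRegularityIndex K isField (toricSet K isField G) ((q ∸ 2) * (k ∸ 1))
-- A field has at least the two elements 0 and 1, which excludes `q = 0` here and `q = 1` in the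
-- next clause.
corollary5p5 K isField zero card k s G m l 1≤m 2≤l cycles =
  contradiction (Inverse.to card (CommutativeRing.0# K)) Fin.¬Fin0
corollary5p5 K isField (suc zero) card k s G m l 1≤m 2≤l cycles =
  contradiction (trans (sym (strictlyInverseʳ 1#)) (trans (from-cong (all-equal (to 1#) (to 0#))) (strictlyInverseʳ 0#))) 1≉0
  where
  open CommutativeRing K using (0#; 1#; sym; trans)
  open IsField isField
  open Inverse card

  all-equal : (i j : Fin 1) → i ≡ j
  all-equal zero zero = ≡.refl
-- Without vertices no component could be nonempty, yet component `zero` contains a vertex.
corollary5p5 K isField (suc (suc r)) card zero s G (suc m) l 1≤m 2≤l cycles =
  contradiction (proj₁ (ComponentsAreCycles.component-surjective cycles zero)) Fin.¬Fin0
-- The edge leaving vertex `zero` serves as the distinguished coordinate `e₀`.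
corollary5p5 K isField (suc (suc r)) card (suc k′) s G m l 1≤m 2≤l cycles =
  ToricSet.isRegularityIndex K isField r card G cyclicOrientation k′ ≡.refl (edge zero)
  where open CycleComponents G m l 2≤l cycles
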